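{- In the mobile telephone model with tag length $b=0$ and any stability factor $\tau\ge 1$, the BlindMatch gossip algorithm solves the gossip problem in $O\left((1/\alpha)\,k\,\Delta^2\log^2 N\right)$ rounds, where $k$ is the number of tokens, $N\ge n$ is the upper bound on the network size $n$ given to the nodes, and $\alpha$ and $\Delta$ are the vertex expansion and maximum degree of the dynamic graph describing the network topology.
   Context: Mobile telephone model. Time proceeds in synchronous rounds $1,2,\dots$, and all nodes start in round 1. The topology is a dynamic graph $G_1,G_2,\dots$ fixed before the execution begins, where each $G_r=(V,E_r)$ is a connected undirected graph on the same node set $V$, $|V|=n>1$. Stability factor $\tau\ge1$: at least $\tau$ rounds pass between any two changes of the topology ($\tau=1$: it may change arbitrarily every round; $\tau=\infty$: it never changes). At the beginning of round $r$ each node selects a tag of $b$ bits to advertise ($b=0$: no tag), then learns its neighbor set in $G_r$ and the tags of its neighbors. Each node may then send a connection proposal to at most one neighbor. A node that sends a proposal cannot receive one; a node that does not send a proposal and receives at least one proposal accepts one chosen uniformly at random among those received. A proposer and acceptor are then connected for the round and may exchange at most $O(1)$ tokens and $O(\mathrm{polylog}(N))$ additional bits. Graph parameters. For a graph $G=(V,E)$ and $S\subseteq V$ nonempty, $\partial S$ is the set of nodes in $V\setminus S$ with a neighbor in $S$, and $\alpha(G)=\min_{S\subset V,\,0<|S|\le n/2}|\partial S|/|S|$. For a dynamic graph, $\alpha=\min_i\alpha(G_i)$ and $\Delta$ is the largest maximum degree of any $G_i$. Gossip problem. Each node knows an upper bound $N\ge n$ and has a unique ID in $[N]=\{1,\dots,N\}$.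 There are $k$ tokens, $1\le k\le n$ ($k$ is not known to the nodes), each initially held by exactly one node; tokens are black boxes, labelled by distinct elements of $[N]$ (which orders them), that can only be passed through connections. $T_u(r)$ is the set of tokens known by $u$ at the beginning of round $r$. An algorithm solves gossip in $f$ rounds if, with probability at least $1-1/n$, all nodes know all $k$ tokens by round $f$. $O(\cdot)$ is asymptotic with universal constants. Transfer$(\varepsilon)$ subroutine. Run by two connected nodes $u,v$ with token sets $T_u,T_v$ (using fresh private randomness, and $O(\log^2 N\cdot\log(\log N/\varepsilon))$ control bits); if $T_u\ne T_v$, then with probability at least $1-\varepsilon$ the smallest token in $(T_u\cup T_v)\setminus(T_u\cap T_v)$ is transferred by the node that knows it to the node that does not. In all cases nodes only gain tokens that the other node knows. BlindMatch. In each round each node independently flips a fair coin to be a sender or a receiver. A sender chooses a neighbor uniformly at random among its current neighbors and sends it a connection proposal. A receiver waits for proposals. If two nodes connect they run Transfer$(\varepsilon)$, where $\varepsilon=N^{ -c}$ for a sufficiently large constant $c$. -}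

module Defs where

open import Algebra.Properties.CommutativeMonoid.Sum using (sum)
open import Data.Bool.Base using (Bool; true; false; if_then_else_)
open import Data.Fin.Base as Fin using (Fin; zero; suc)
open import Data.Fin.Properties as Fin using (any?; all?)
open import Data.Fin.Subset
  using (Subset; _∈_; _∉_; _⊆_; _∪_; _∩_; _─_; ∣_∣; Nonempty; ⊤)
open import Data.Fin.Subset.Properties
  using (_∈?_; _⊆?_; x∈p⇒p-x⊂p; ∣⊤∣≡n; nonempty?; Empty-unique; ∣⊥∣≡0;
         p⊆q⇒∣p∣≤∣q∣; p⊂q⇒∣p∣<∣q∣)
open import Data.Integer.Base using (+_)
open import Data.List.Base as List using (List; []; _∷_; allFin; filter; length)
open import Data.Maybe.Base using (Maybe; just; nothing)
open import Data.Maybe.Properties using (≡-dec)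
open import Data.Nat.Base as ℕ using (ℕ; zero; suc; _^_; NonZero)
import Data.Nat.Properties as ℕ
open import Data.Product.Base using (∃; ∃-syntax; Σ-syntax; _×_; _,_; proj₁; proj₂)
open import Data.Rational.Base as ℚ using (ℚ; 0ℚ; 1ℚ; _/_)
import Data.Rational.Properties as ℚ
open import Data.Vec.Base using (tabulate)
import Data.Vec.Functional as Vector
open import Data.Vec.Properties using (lookup⇒[]=; lookup∘tabulate)
open import Function.Base using (_∘_)
open import Function.Definitions using (Injective)
open import Level using (0ℓ)
open import Relation.Binary.Construct.Closure.ReflexiveTransitive using (Star; ε; _◅_)
open import Relation.Binary.Core using (Rel)
open import Relation.Binary.PropositionalEquality
  using (_≡_; _≢_; refl; sym; trans; cong; subst)
open import Relation.Nullary using (¬_; does; yes; no; contradiction)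
open import Relation.Nullary.Decidable using (_×-dec_; ¬?; dec-true)
open import Relation.Unary using (Decidable)

private variable
  n N : ℕ
  A B : Set

Extremum : Rel A 0ℓ → (A → Set) → A → Set
Extremum _≼_ P a = P a × (∀ {b} → P b → a ≼ b)

fromℕ : ℕ → ℚ
fromℕ m = + m / 1

------------------------------------------------------------------------
-- Randomized computations

-- Finite trees of uniform choices; choices made along different nodes of the
-- tree are independent.
data Rand (A : Set) : Set where
  return : A → Rand A
  pick   : (m : ℕ) → (Fin (suc m) → Rand A) → Rand A

infixl 1 _>>=_
_>>=_ : Rand A → (A → Rand B) → Rand B
return x >>= f = f x
pick m t >>= f = pick m λ i → t i >>= f

𝔼 : (A → ℚ) → Rand A → ℚ
𝔼 φ (return x) = φ x
𝔼 φ (pick m t) = (+ 1 / suc m) ℚ.* sum ℚ.+-0-commutativeMonoid (λ i → 𝔼 φ (t i))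

Pr : {P : A → Set} → Decidable P → Rand A → ℚ
Pr P? = 𝔼 λ x → if does (P? x) then 1ℚ else 0ℚ

-- Every leaf has positive probability, so this is "in all cases".
Always : (A → Set) → Rand A → Set
Always P (return x) = P x
Always P (pick m t) = ∀ i → Always P (t i)

coin : Rand Bool
coin = pick 1 λ { zero → return true ; (suc _) → return false }

uniform : List A → Rand (Maybe A)
uniform []       = return nothing
uniform (x ∷ xs) = pick (length xs) λ i → return (just (List.lookup (x ∷ xs) i))

independently : (Fin n → Rand A) → Rand (Fin n → A)
independently {n = zero}  f = return Vector.[]
independently {n = suc n} f = do
  x  ← f zero
  xs ← independently (f ∘ suc)
  return (x Vector.∷ xs)

------------------------------------------------------------------------
-- Graphs

record Graph (n : ℕ) : Set where
  field
    nbrs        : Fin n → Subset n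
    symmetric   : ∀ {u v} → v ∈ nbrs u → u ∈ nbrs v
    irreflexive : ∀ {u} → u ∉ nbrs u

  degree : Fin n → ℕ
  degree u = ∣ nbrs u ∣

  Connected : Set
  Connected = ∀ u v → Star (λ x y → y ∈ nbrs x) u v

  InBoundary : Subset n → Fin n → Set
  InBoundary S v = v ∉ S × ∃[ u ] u ∈ S × u ∈ nbrs v

  inBoundary? : ∀ S → Decidable (InBoundary S)
  inBoundary? S v = ¬? (v ∈? S) ×-dec any? λ u → (u ∈? S) ×-dec (u ∈? nbrs v)

  ∂ : Subset n → Subset n
  ∂ S = tabulate (does ∘ inBoundary? S)

  IsMaxDegree : ℕ → Set
  IsMaxDegree = Extremum ℕ._≥_ λ d → ∃[ u ] d ≡ degree u

  IsExpansion : ℚ → Set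
  IsExpansion = Extremum ℚ._≤_ λ q →
    ∃[ S ] Σ[ S≢∅ ∈ NonZero ∣ S ∣ ]
      2 ℕ.* ∣ S ∣ ℕ.≤ n × q ≡ (+ ∣ ∂ S ∣ / ∣ S ∣) {{S≢∅}}

open Graph using (nbrs; Connected; IsMaxDegree; IsExpansion)

-- graph r is the topology of round r + 1.
record DynamicGraph (n : ℕ) : Set where
  field
    graph     : ℕ → Graph n
    connected : ∀ r → Connected (graph r)

  Unchanged : ℕ → Set
  Unchanged r = ∀ u → nbrs (graph r) u ≡ nbrs (graph (suc r)) u

  -- Extrema over the rounds; stated relationally because finding the minimum
  -- of an infinite sequence of graphs is not constructive.
  HasMaxDegree : ℕ → Set
  HasMaxDegree = Extremum ℕ._≥_ λ d → ∃[ r ] IsMaxDegree (graph r) d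

  HasExpansion : ℚ → Set
  HasExpansion = Extremum ℚ._≤_ λ q → ∃[ r ] IsExpansion (graph r) q

open DynamicGraph using (graph; connected; Unchanged; HasMaxDegree; HasExpansion)

data StabilityFactor : Set where
  finite : (τ : ℕ) → .{{NonZero τ}} → StabilityFactor
  ∞      : StabilityFactor

HasStability : DynamicGraph n → StabilityFactor → Set
HasStability G (finite τ) =
  ∀ {r s} → r ℕ.< s → ¬ Unchanged G r → ¬ Unchanged G s → r ℕ.+ τ ℕ.≤ s
HasStability G ∞ = ∀ r → Unchanged G r

------------------------------------------------------------------------
-- The gossip problem

-- IDs and token labels in [N] are represented by Fin N.
record Nodes (n N : ℕ) : Set where
  field
    1<n          : 1 ℕ.< n
    n≤N          : n ℕ.≤ N
    id           : Fin n → Fin N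
    id-injective : Injective _≡_ _≡_ id

  n≢0 : NonZero n
  n≢0 = ℕ.>-nonZero (ℕ.<-trans ℕ.z<s 1<n)

  N≢0 : NonZero N
  N≢0 = ℕ.>-nonZero (ℕ.<-≤-trans (ℕ.<-trans ℕ.z<s 1<n) n≤N)

  -- N⁻ᶜ
  N^-_ : ℕ → ℚ
  N^- c = (+ 1 / N ^ c) {{ℕ.m^n≢0 N c {{N≢0}}}}

open Nodes using (id; n≢0; N^-_)

-- The set of tokens known by each node.
Knowledge : ℕ → ℕ → Set
Knowledge n N = Fin n → Subset N

record Tokens (n N k : ℕ) : Set where
  field
    tokens    : Subset N
    ∣tokens∣≡k : ∣ tokens ∣ ≡ k
    1≤k       : 1 ℕ.≤ k
    k≤n       : k ℕ.≤ n
    initial   : Knowledge n N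
    initial⊆  : ∀ u → initial u ⊆ tokens
    unique    : ∀ {t} → t ∈ tokens →
                ∃[ u ] t ∈ initial u × (∀ {v} → t ∈ initial v → v ≡ u)

  AllKnowAll : Knowledge n N → Set
  AllKnowAll T = ∀ u → tokens ⊆ T u

  allKnowAll? : Decidable AllKnowAll
  allKnowAll? T = all? λ u → tokens ⊆? T u

open Tokens using (initial; allKnowAll?)

-- executions f is the random knowledge once f rounds have been completed.
SolvesGossipIn : Nodes n N → ∀ {k} → Tokens n N k →
                 (executions : ℕ → Rand (Knowledge n N)) → ℕ → Set
SolvesGossipIn {n} nodes toks executions f =
  1ℚ ℚ.- (+ 1 / n) {{n≢0 nodes}} ℚ.≤ Pr (allKnowAll? toks) (executions f)

------------------------------------------------------------------------
-- The mobile telephone model with tag length 0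

-- A token exchange, given the IDs and token sets of the proposer and of the
-- acceptor, yields their new token sets, in the same order.
Exchange : ℕ → Set
Exchange N = (idᵤ idᵥ : Fin N) (Tᵤ Tᵥ : Subset N) → Rand (Subset N × Subset N)

module Round (nodes : Nodes n N) (G : Graph n)
             (propose : Subset n → Rand (Maybe (Fin n)))  -- from the neighbor set
             (exchange : Exchange N) where

  Choices : Set
  Choices = Fin n → Maybe (Fin n)

  proposersTo : Choices → Fin n → List (Fin n)
  proposersTo proposal v = filter (λ u → ≡-dec Fin._≟_ (proposal u) (just v)) (allFin n)

  accept : Choices → Fin n → Rand (Maybe (Fin n))
  accept proposal v with proposal v
  ... | just _  = return nothing
  ... | nothing = uniform (proposersTo proposal v)

  -- Indexed by acceptors; the first component is the proposer's new set. It is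
  -- consulted only when v has accepted a proposal.
  connect : Knowledge n N → Choices → Fin n → Rand (Subset N × Subset N)
  connect T accepted v with accepted v
  ... | just u  = exchange (id nodes u) (id nodes v) (T u) (T v)
  ... | nothing = return (T v , T v)

  update : Knowledge n N → (proposal accepted : Choices) →
           (Fin n → Subset N × Subset N) → Knowledge n N
  update T proposal accepted result w with proposal w
  ... | nothing = proj₂ (result w)
  ... | just v  =
    if does (≡-dec Fin._≟_ (accepted v) (just w)) then proj₁ (result v) else T w

  round : Knowledge n N → Rand (Knowledge n N)
  round T = do
    proposal ← independently λ u → propose (nbrs G u)
    accepted ← independently (accept proposal)
    result   ← independently (connect T accepted)
    return (update T proposal accepted result)

------------------------------------------------------------------------
-- BlindMatch

-- Any implementation of Transfer(ε): each call to run draws fresh randomness.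
record Transfer (N : ℕ) (ε : ℚ) : Set where
  field
    run : Exchange N

    gains-only : ∀ {idᵤ idᵥ} → idᵤ ≢ idᵥ → ∀ Tᵤ Tᵥ →
      Always (λ (Tᵤ′ , Tᵥ′) → (Tᵤ ⊆ Tᵤ′ × Tᵤ′ ⊆ Tᵤ ∪ Tᵥ) ×
                              (Tᵥ ⊆ Tᵥ′ × Tᵥ′ ⊆ Tᵤ ∪ Tᵥ))
             (run idᵤ idᵥ Tᵤ Tᵥ)

    -- A smallest such t exists exactly when Tᵤ ≢ Tᵥ. As exactly one of the two
    -- nodes knows t beforehand, it is transferred when both know it afterwards.
    transfers : ∀ {idᵤ idᵥ} → idᵤ ≢ idᵥ → ∀ Tᵤ Tᵥ {t} →
      Extremum Fin._≤_ (_∈ (Tᵤ ∪ Tᵥ) ─ (Tᵤ ∩ Tᵥ)) t →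
      1ℚ ℚ.- ε ℚ.≤ Pr (λ (Tᵤ′ , Tᵥ′) → (t ∈? Tᵤ′) ×-dec (t ∈? Tᵥ′))
                      (run idᵤ idᵥ Tᵤ Tᵥ)

blindPropose : Subset n → Rand (Maybe (Fin n))
blindPropose neighbors = do
  sender ← coin
  if sender then uniform (filter (_∈? neighbors) (allFin _)) else return nothing

blindMatch : Nodes n N → ∀ {ε} → Transfer N ε → DynamicGraph n →
             Knowledge n N → ℕ → Rand (Knowledge n N)
blindMatch nodes transfer G T₁ zero    = return T₁
blindMatch nodes transfer G T₁ (suc r) =
  blindMatch nodes transfer G T₁ r >>=
    Round.round nodes (graph G r) blindPropose (Transfer.run transfer)

------------------------------------------------------------------------
-- The vertex expansion is nonzero, so that 1/α makes sense

module _ (G : Graph n) (conn : Connected G) where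
  open Graph G using (∂; inBoundary?; InBoundary)

  private
    crossing : ∀ S {u v} → Star (λ x y → y ∈ nbrs G x) u v → u ∈ S → v ∉ S →
               ∃ (InBoundary S)
    crossing S ε u∈S v∉S = contradiction u∈S v∉S
    crossing S (_◅_ {_} {w} e es) u∈S v∉S with w ∈? S
    ... | yes w∈S = crossing S es w∈S v∉S
    ... | no  w∉S = w , w∉S , _ , u∈S , Graph.symmetric G e

    member : ∀ (S : Subset n) → NonZero ∣ S ∣ → Nonempty S
    member S S≢∅ with nonempty? S
    ... | yes x = x
    ... | no ¬x = contradiction (trans (cong ∣_∣ (Empty-unique ¬x)) (∣⊥∣≡0 n))
                                (ℕ.≢-nonZero⁻¹ ∣ S ∣ {{S≢∅}})

    nonMember : ∀ (S : Subset n) → NonZero ∣ S ∣ → 2 ℕ.* ∣ S ∣ ℕ.≤ n → ∃ (_∉ S)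
    nonMember S S≢∅ 2∣S∣≤n with any? (λ x → ¬? (x ∈? S))
    ... | yes x = x
    ... | no ¬x = contradiction n≤∣S∣ (ℕ.<⇒≱ (ℕ.<-≤-trans ∣S∣<2∣S∣ 2∣S∣≤n))
      where
      ∣S∣<2∣S∣ : ∣ S ∣ ℕ.< 2 ℕ.* ∣ S ∣
      ∣S∣<2∣S∣ = ℕ.m<m+n ∣ S ∣ (subst (0 ℕ.<_) (sym (ℕ.+-identityʳ ∣ S ∣))
                                    (ℕ.>-nonZero⁻¹ ∣ S ∣ {{S≢∅}}))
      ⊤⊆S : ⊤ ⊆ S
      ⊤⊆S {x} _ with x ∈? S
      ... | yes x∈S = x∈S
      ... | no  x∉S = contradiction (x , x∉S) ¬x
      n≤∣S∣ : n ℕ.≤ ∣ S ∣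
      n≤∣S∣ = subst (ℕ._≤ ∣ S ∣) (∣⊤∣≡n n) (p⊆q⇒∣p∣≤∣q∣ ⊤⊆S)

    ∂-nonZero : ∀ S → NonZero ∣ S ∣ → 2 ℕ.* ∣ S ∣ ℕ.≤ n → 1 ℕ.≤ ∣ ∂ S ∣
    ∂-nonZero S S≢∅ 2∣S∣≤n
      with u , u∈S ← member S S≢∅ | v , v∉S ← nonMember S S≢∅ 2∣S∣≤n
      with w , w∈∂ ← crossing S (conn u v) u∈S v∉S =
      nonempty (lookup⇒[]= w (∂ S)
        (trans (lookup∘tabulate _ w) (dec-true (inBoundary? S w) w∈∂)))
      where
      nonempty : ∀ {x} {p : Subset n} → x ∈ p → 1 ℕ.≤ ∣ p ∣
      nonempty {x} {p} x∈p = ℕ.≤-<-trans ℕ.z≤n (p⊂q⇒∣p∣<∣q∣ (x∈p⇒p-x⊂p x∈p))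

  expansion-positive : ∀ {α} → IsExpansion G α → ℚ.Positive α
  expansion-positive ((S , S≢∅ , 2∣S∣≤n , refl) , _) =
    ℚ.normalize-pos ∣ ∂ S ∣ ∣ S ∣ {{S≢∅}} {{ℕ.>-nonZero (∂-nonZero S S≢∅ 2∣S∣≤n)}}

expansion≢0 : (G : DynamicGraph n) → ∀ {α} → HasExpansion G α → ℚ.NonZero α
expansion≢0 G {α} ((r , exp) , _) =
  ℚ.pos⇒nonZero α {{expansion-positive (graph G r) (connected G r) exp}}

-- Fix a token t, let s be the number of nodes that know it, and put Φ = n/s − 1. If every
-- smaller token is known everywhere, a connection between a node u that knows t and a node
-- v that does not passes on t with probability at least 1/2, and an edge {u , v} becomes
-- such a connection, with u proposing, with probability at least 1/(4Δ²). Both the boundary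
-- of the knowers and that of the ignorant nodes consist of endpoints of such edges, so at
-- least α min(s , n − s) new knowers are expected per round, up to a factor 8Δ². A round at
-- most doubles the knowers counted, so 1/s may be linearized and E Φ shrinks by a factor
-- 1 − α/(16Δ²). Weighting the i-th smallest of the k tokens by n^(2(k−i)) gives one
-- potential Ψ for all tokens: as Φ is 0 or at least 1/n, the smallest incomplete token
-- carries at least half of Ψ, whence E Ψ shrinks by 1 − α/(32Δ²) in every round. Since
-- n Ψ ≤ n^(2k) initially and n Ψ ≥ 1 until gossip is solved, Markov's inequality applies
-- after O(k log n · Δ²/α) rounds.
module Submission where

open import Defs
open import Algebra.Bundles using (CommutativeRing)
open import Data.Bool.Base using (true; false; if_then_else_)
open import Data.Fin.Base as Fin using (Fin; zero; suc)
import Data.Fin.Properties as Fin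
open import Data.Fin.Subset
  using (Subset; inside; outside; _∈_; _∉_; _⊆_; _∪_; _∩_; _─_; ∁; ∣_∣; ⁅_⁆; ⊤)
open import Data.Fin.Subset.Properties
  using (_∈?_; x∈p∪q⁻; x∈p∪q⁺; x∈p∩q⁻; x∈p∩q⁺; x∈p∧x∉q⇒x∈p─q; p─q⊆p; x∈⁅y⁆⇒x≡y;
         ∣⁅x⁆∣≡1; p⊆q⇒∣p∣≤∣q∣; ∣p∣≤n; ∣⊤∣≡n; ∣∁p∣≡n∸∣p∣; x∉p⇒x∈∁p; x∈∁p⇒x∉p; x∉∁p⇒x∈p)
import Data.Integer.Base as ℤ
import Data.Integer.Properties as ℤ
open import Data.List.Base as List using (List; []; _∷_; filter; length; allFin)
open import Data.List.Membership.Propositional using () renaming (_∈_ to _∈ˡ_)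
open import Data.List.Membership.Propositional.Properties
  using (∈-lookup; ∈-filter⁻; ∈-filter⁺; ∈-allFin)
open import Data.List.Relation.Unary.All as All using (All; []; _∷_)
open import Data.List.Relation.Unary.AllPairs using (AllPairs; []; _∷_)
import Data.List.Relation.Unary.AllPairs.Properties as AllPairs
open import Data.List.Relation.Unary.Any using (here; there; index)
open import Data.List.Relation.Unary.Any.Properties using (lookup-index)
open import Data.Maybe.Base using (Maybe; just; nothing)
open import Data.Maybe.Properties using (≡-dec; just-injective)
open import Data.Nat.Base as ℕ using (ℕ; zero; suc; NonZero; z≤n; s≤s)
import Data.Nat.Properties as ℕ
open import Data.Nat.Logarithm using (⌊log₂_⌋; ⌊log₂⌋-mono-≤; ⌊log₂[2^n]⌋≡n)
open import Data.Nat.Tactic.RingSolver using (solve-∀)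
open import Data.Product.Base using (∃; ∃-syntax; Σ-syntax; _×_; _,_; proj₁; proj₂)
open import Data.Rational.Base as ℚ
  using (ℚ; 0ℚ; 1ℚ; ½; _/_; _+_; _-_; -_; _*_; _≤_; 1/_; nonNegative; Positive)
import Data.Rational.Properties as ℚ
open import Data.Rational.Solver using (module +-*-Solver)
import Data.Rational.Unnormalised.Base as ℚᵘ
import Data.Rational.Unnormalised.Properties as ℚᵘ
open import Data.Sum.Base as Sum using (_⊎_; inj₁; inj₂)
open import Data.Vec.Base using ([]; _∷_; here; there; tabulate)
import Data.Vec.Functional as Vector
open import Data.Vec.Properties using (lookup⇒[]=; []=⇒lookup; lookup∘tabulate)
open import Function.Base using (_∘_; id; flip)
open import Level using (0ℓ)
open import Relation.Binary.Core using (Rel)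
open import Relation.Binary.Definitions using (Total; Transitive)
open import Relation.Binary.PropositionalEquality
open import Relation.Nullary using (¬_; Dec; does; yes; no; contradiction)
open import Relation.Nullary.Decidable using (dec-true; _×-dec_; ¬?; from-no)
open import Relation.Unary using (Decidable)
open import Algebra.Properties.Semiring.Exp (CommutativeRing.semiring ℚ.+-*-commutativeRing)
  using (^-homo-*) renaming (_^_ to _^^_)
open import Algebra.Properties.Semiring.Sum (CommutativeRing.semiring ℚ.+-*-commutativeRing)
  using (sum; sum-cong-≗; ∑-distrib-+; ∑-comm; *-distribˡ-sum; sum-replicate-zero)
open +-*-Solver

-- `Transfer` moves only the smallest token on which two nodes differ, so a larger token may make no
-- progress while a smaller one is incomplete. A proof in phases, one per token, would have to add
-- up k random stopping times; the weighted sum `Ψ` needs only an expected decrease in each round.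
-- The base n² of the weights reflects that Φ lies between 1/n and n - 1 while a token is
-- incomplete. The reciprocal 1/s is chosen because it turns expansion into a constant rate during
-- the whole spread: min(s , n - s) ≥ s(n - s)/n, and the slope n/(2s²) times this is half of (n -
-- s)/s = Φ. As the linear bound holds for every outcome of a round, the number of new knowers
-- enters only through its expectation, which is a sum over edges. Only connections in which the
-- knower proposes are counted: a knower then has one target and an ignorant node accepts one
-- proposal, which bounds the count from both sides.

private variable
  n N : ℕ
  A B : Set
  P Q : A → Set
  p ε : ℚ

-- Order arithmetic of the rationals and the embedding of the natural numbers

module _ where
  private variable
    q r s : ℚ

  ≡-≤-trans : p ≡ q → q ≤ r → p ≤ r
  ≡-≤-trans refl q≤r = q≤r

  ≤-≡-trans : p ≤ q → q ≡ r → p ≤ r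
  ≤-≡-trans p≤q refl = p≤q

  -- Reduces an inequality to a polynomial identity with an explicit nonnegative gap; the identity
  -- then goes to the ring solver.
  ≤-by-gap : 0ℚ ≤ r → q ≡ p + r → p ≤ q
  ≤-by-gap {r} {q} {p} 0≤r refl = subst (_≤ p + r) (ℚ.+-identityʳ p) (ℚ.+-monoʳ-≤ p 0≤r)

  gap≥0 : p ≤ q → 0ℚ ≤ q - p
  gap≥0 {p} p≤q = ≡-≤-trans (sym (ℚ.+-inverseʳ p)) (ℚ.+-monoˡ-≤ (- p) p≤q)

  0≤+ : 0ℚ ≤ p → 0ℚ ≤ q → 0ℚ ≤ p + q
  0≤+ = ℚ.+-mono-≤

  0≤* : 0ℚ ≤ p → 0ℚ ≤ q → 0ℚ ≤ p * q
  0≤* {p} {q} 0≤p 0≤q = ℚ.nonNegative⁻¹ (p * q)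
    {{ℚ.nonNeg*nonNeg⇒nonNeg p {{nonNegative 0≤p}} q {{nonNegative 0≤q}}}}

  *-monoʳ : 0ℚ ≤ r → p ≤ q → r * p ≤ r * q
  *-monoʳ {r} 0≤r = ℚ.*-monoˡ-≤-nonNeg r {{nonNegative 0≤r}}

  *-monoˡ : 0ℚ ≤ r → p ≤ q → p * r ≤ q * r
  *-monoˡ {r} 0≤r = ℚ.*-monoʳ-≤-nonNeg r {{nonNegative 0≤r}}

  *-mono : 0ℚ ≤ p → 0ℚ ≤ s → p ≤ q → r ≤ s → p * r ≤ q * s
  *-mono 0≤p 0≤s p≤q r≤s = ℚ.≤-trans (*-monoʳ 0≤p r≤s) (*-monoˡ 0≤s p≤q)

0≤1 : 0ℚ ≤ 1ℚ
0≤1 = ℚ.nonNegative⁻¹ 1ℚ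

0≤½ : 0ℚ ≤ ½
0≤½ = ℚ.nonNegative⁻¹ ½

-- `fromℕ` normalises its fraction by a gcd that is stuck on open terms, so the sum is compared in
-- the unnormalised rationals, where equality is cross multiplication.
fromℕ-+ : ∀ a b → fromℕ (a ℕ.+ b) ≡ fromℕ a + fromℕ b
fromℕ-+ a b = ℚ.toℚᵘ-injective (begin
  ℚ.toℚᵘ (fromℕ (a ℕ.+ b))                 ≈⟨ ℚ.toℚᵘ-fromℚᵘ (ℚᵘ.mkℚᵘ (ℤ.+ (a ℕ.+ b)) 0) ⟩
  ℚᵘ.mkℚᵘ (ℤ.+ (a ℕ.+ b)) 0                  ≈⟨ ℚᵘ.*≡* (cong (ℤ._* ℤ.+ 1) (sym (cong₂ ℤ._+_ (ℤ.*-identityʳ (ℤ.+ a)) (ℤ.*-identityʳ (ℤ.+ b))))) ⟩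
  ℚᵘ.mkℚᵘ (ℤ.+ a) 0 ℚᵘ.+ ℚᵘ.mkℚᵘ (ℤ.+ b) 0      ≈⟨ ℚᵘ.+-cong (ℚ.toℚᵘ-fromℚᵘ (ℚᵘ.mkℚᵘ (ℤ.+ a) 0)) (ℚ.toℚᵘ-fromℚᵘ (ℚᵘ.mkℚᵘ (ℤ.+ b) 0)) ⟨
  ℚ.toℚᵘ (fromℕ a) ℚᵘ.+ ℚ.toℚᵘ (fromℕ b)    ≈⟨ ℚ.toℚᵘ-homo-+ (fromℕ a) (fromℕ b) ⟨
  ℚ.toℚᵘ (fromℕ a + fromℕ b)               ∎)
  where open ℚᵘ.≃-Reasoning

/-* : ∀ a b .{{_ : NonZero b}} → (ℤ.+ a / b) * fromℕ b ≡ fromℕ a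
/-* a (suc b) = ℚ.toℚᵘ-injective (begin
  ℚ.toℚᵘ ((ℤ.+ a / suc b) * fromℕ (suc b))            ≈⟨ ℚ.toℚᵘ-homo-* (ℤ.+ a / suc b) (fromℕ (suc b)) ⟩
  ℚ.toℚᵘ (ℤ.+ a / suc b) ℚᵘ.* ℚ.toℚᵘ (fromℕ (suc b))  ≈⟨ ℚᵘ.*-cong (ℚ.toℚᵘ-fromℚᵘ (ℚᵘ.mkℚᵘ (ℤ.+ a) b)) (ℚ.toℚᵘ-fromℚᵘ (ℚᵘ.mkℚᵘ (ℤ.+ suc b) 0)) ⟩
  ℚᵘ.mkℚᵘ (ℤ.+ a) b ℚᵘ.* ℚᵘ.mkℚᵘ (ℤ.+ suc b) 0          ≈⟨ ℚᵘ.*≡* (trans (ℤ.*-identityʳ (ℤ.+ a ℤ.* ℤ.+ suc b)) (cong (λ x → ℤ.+ a ℤ.* ℤ.+ suc x) (sym (ℕ.*-identityʳ b)))) ⟩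
  ℚᵘ.mkℚᵘ (ℤ.+ a) 0                                   ≈⟨ ℚ.toℚᵘ-fromℚᵘ (ℚᵘ.mkℚᵘ (ℤ.+ a) 0) ⟨
  ℚ.toℚᵘ (fromℕ a)                                  ∎)
  where open ℚᵘ.≃-Reasoning

fromℕ-* : ∀ a b → fromℕ (a ℕ.* b) ≡ fromℕ a * fromℕ b
fromℕ-* zero    b = sym (ℚ.*-zeroˡ (fromℕ b))
fromℕ-* (suc a) b = begin
  fromℕ (b ℕ.+ a ℕ.* b)           ≡⟨ fromℕ-+ b (a ℕ.* b) ⟩
  fromℕ b + fromℕ (a ℕ.* b)       ≡⟨ cong (fromℕ b +_) (fromℕ-* a b) ⟩
  fromℕ b + fromℕ a * fromℕ b     ≡⟨ solve 2 (λ x y → y :+ x :* y := (con 1ℚ :+ x) :* y) refl (fromℕ a) (fromℕ b) ⟩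
  (1ℚ + fromℕ a) * fromℕ b        ≡⟨ cong (_* fromℕ b) (fromℕ-+ 1 a) ⟨
  fromℕ (suc a) * fromℕ b         ∎
  where open ≡-Reasoning

0≤fromℕ : ∀ a → 0ℚ ≤ fromℕ a
0≤fromℕ a = ℚ.nonNegative⁻¹ (fromℕ a) {{ℚ.normalize-nonNeg a 1}}

fromℕ-mono : ∀ {a b} → a ℕ.≤ b → fromℕ a ≤ fromℕ b
fromℕ-mono {a} {b} a≤b = ≤-by-gap (0≤fromℕ (b ℕ.∸ a))
  (trans (cong fromℕ (sym (ℕ.m+[n∸m]≡n a≤b))) (fromℕ-+ a (b ℕ.∸ a)))

fromℕ-suc : ∀ a → fromℕ (suc a) ≡ 1ℚ + fromℕ a
fromℕ-suc = fromℕ-+ 1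

0≤1/ : ∀ b .{{_ : NonZero b}} → 0ℚ ≤ ℤ.+ 1 / b
0≤1/ b = ℚ.nonNegative⁻¹ (ℤ.+ 1 / b) {{ℚ.normalize-nonNeg 1 b}}

-- Indicators and finite sums

𝟙 : {P : Set} → Dec P → ℚ
𝟙 P? = if does P? then 1ℚ else 0ℚ

0≤𝟙 : {P : Set} (P? : Dec P) → 0ℚ ≤ 𝟙 P?
0≤𝟙 P? with does P?
... | true  = 0≤1
... | false = ℚ.≤-refl

𝟙-true : {P : Set} (P? : Dec P) → P → 𝟙 P? ≡ 1ℚ
𝟙-true P? x rewrite dec-true P? x = refl

𝟙-lower : {P : Set} (P? : Dec P) → 0ℚ ≤ p → (P → 1ℚ ≤ p) → 𝟙 P? ≤ p
𝟙-lower (yes x) 0≤p f = f x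
𝟙-lower (no _)  0≤p f = 0≤p

𝟙-mono : {P Q : Set} (P? : Dec P) (Q? : Dec Q) → (P → Q) → 𝟙 P? ≤ 𝟙 Q?
𝟙-mono P? Q? f = 𝟙-lower P? (0≤𝟙 Q?) (λ x → ℚ.≤-reflexive (sym (𝟙-true Q? (f x))))

sum-mono : {f g : Fin n → ℚ} → (∀ i → f i ≤ g i) → sum f ≤ sum g
sum-mono {zero}  f≤g = ℚ.≤-refl
sum-mono {suc n} f≤g = ℚ.+-mono-≤ (f≤g zero) (sum-mono (f≤g ∘ suc))

0≤sum : {f : Fin n → ℚ} → (∀ i → 0ℚ ≤ f i) → 0ℚ ≤ sum f
0≤sum {n} 0≤f = ≡-≤-trans (sym (sum-replicate-zero n)) (sum-mono 0≤f)

sum-const : ∀ n p → sum {n} (λ _ → p) ≡ fromℕ n * p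
sum-const zero    p = sym (ℚ.*-zeroˡ p)
sum-const (suc n) p = begin
  p + sum {n} (λ _ → p)  ≡⟨ cong (p +_) (sum-const n p) ⟩
  p + fromℕ n * p        ≡⟨ solve 2 (λ p x → p :+ x :* p := (con 1ℚ :+ x) :* p) refl p (fromℕ n) ⟩
  (1ℚ + fromℕ n) * p     ≡⟨ cong (_* p) (fromℕ-suc n) ⟨
  fromℕ (suc n) * p      ∎
  where open ≡-Reasoning

term≤sum : {f : Fin n → ℚ} → (∀ i → 0ℚ ≤ f i) → ∀ i → f i ≤ sum f
term≤sum {suc n} {f} 0≤f zero    = ≤-by-gap (0≤sum (0≤f ∘ suc)) refl
term≤sum {suc n} {f} 0≤f (suc i) = ℚ.≤-trans (term≤sum (0≤f ∘ suc) i)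
  (≤-by-gap (0≤f zero) (ℚ.+-comm (f zero) _))

sum-single≤ : {f : Fin n → ℚ} {i : Fin n} → (∀ j → j ≢ i → f j ≤ 0ℚ) → f i ≤ p → sum f ≤ p
sum-single≤ {suc n} {p} {f} {zero} off at = subst (_ ≤_) (ℚ.+-identityʳ p)
  (ℚ.+-mono-≤ at (≤-≡-trans (sum-mono (λ j → off (suc j) λ ())) (sum-replicate-zero n)))
sum-single≤ {suc n} {p} {f} {suc i} off at = subst (_ ≤_) (ℚ.+-identityˡ p)
  (ℚ.+-mono-≤ (off zero λ ()) (sum-single≤ {i = i} (λ j j≢i → off (suc j) λ { refl → j≢i refl }) at))

-- Expectations

sample-mean : ∀ m p → (ℤ.+ 1 / suc m) * (fromℕ (suc m) * p) ≡ p
sample-mean m p = begin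
  (ℤ.+ 1 / suc m) * (fromℕ (suc m) * p)  ≡⟨ ℚ.*-assoc (ℤ.+ 1 / suc m) (fromℕ (suc m)) p ⟨
  (ℤ.+ 1 / suc m) * fromℕ (suc m) * p    ≡⟨ cong (_* p) (/-* 1 (suc m)) ⟩
  1ℚ * p                               ≡⟨ ℚ.*-identityˡ p ⟩
  p                                    ∎
  where open ≡-Reasoning

Always-map : {P Q : A → Set} (m : Rand A) → (∀ x → P x → Q x) → Always P m → Always Q m
Always-map (return x) f a = f x a
Always-map (pick m t) f a = λ i → Always-map (t i) f (a i)

Always-all : {P : A → Set} (m : Rand A) → (∀ x → P x) → Always P m
Always-all (return x) f = f x
Always-all (pick m t) f = λ i → Always-all (t i) f

Always->>= : {P : A → Set} {Q : B → Set} (m : Rand A) {f : A → Rand B} →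
             Always P m → (∀ x → P x → Always Q (f x)) → Always Q (m >>= f)
Always->>= (return x) a g = g x a
Always->>= (pick m t) a g = λ i → Always->>= (t i) (a i) g

Always-independently : {P : Fin n → A → Set} {f : Fin n → Rand A} →
  (∀ i → Always (P i) (f i)) → Always (λ x → ∀ i → P i (x i)) (independently f)
Always-independently {zero}  a = λ ()
Always-independently {suc n} {f = f} a =
  Always->>= (f zero) (a zero) λ x px →
  Always->>= (independently (f ∘ suc)) (Always-independently (a ∘ suc)) λ xs pxs →
  λ { zero → px ; (suc i) → pxs i }

-- The comparison is required only at leaves that satisfy `P`, so facts about every possible outcome
-- can be used pointwise under the expectation.
𝔼-mono : {P : A → Set} {φ ψ : A → ℚ} (m : Rand A) → Always P m →
         (∀ x → P x → φ x ≤ ψ x) → 𝔼 φ m ≤ 𝔼 ψ m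
𝔼-mono (return x) a φ≤ψ = φ≤ψ x a
𝔼-mono (pick m t) a φ≤ψ = *-monoʳ (0≤1/ (suc m)) (sum-mono λ i → 𝔼-mono (t i) (a i) φ≤ψ)

𝔼-cong : {φ ψ : A → ℚ} (m : Rand A) → (∀ x → φ x ≡ ψ x) → 𝔼 φ m ≡ 𝔼 ψ m
𝔼-cong (return x) e = e x
𝔼-cong (pick m t) e = cong ((ℤ.+ 1 / suc m) *_) (sum-cong-≗ λ i → 𝔼-cong (t i) e)

𝔼->>= : (φ : B → ℚ) (m : Rand A) (f : A → Rand B) →
        𝔼 φ (m >>= f) ≡ 𝔼 (λ x → 𝔼 φ (f x)) m
𝔼->>= φ (return x) f = refl
𝔼->>= φ (pick m t) f = cong ((ℤ.+ 1 / suc m) *_) (sum-cong-≗ λ i → 𝔼->>= φ (t i) f)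

𝔼-const : ∀ p (m : Rand A) → 𝔼 (λ _ → p) m ≡ p
𝔼-const p (return x) = refl
𝔼-const p (pick m t) = begin
  (ℤ.+ 1 / suc m) * sum (λ i → 𝔼 (λ _ → p) (t i))  ≡⟨ cong ((ℤ.+ 1 / suc m) *_) (sum-cong-≗ λ i → 𝔼-const p (t i)) ⟩
  (ℤ.+ 1 / suc m) * sum {suc m} (λ _ → p)          ≡⟨ cong ((ℤ.+ 1 / suc m) *_) (sum-const (suc m) p) ⟩
  (ℤ.+ 1 / suc m) * (fromℕ (suc m) * p)            ≡⟨ sample-mean m p ⟩
  p                                              ∎
  where open ≡-Reasoning

𝔼-+ : (φ ψ : A → ℚ) (m : Rand A) → 𝔼 (λ x → φ x + ψ x) m ≡ 𝔼 φ m + 𝔼 ψ m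
𝔼-+ φ ψ (return x) = refl
𝔼-+ φ ψ (pick m t) = begin
  c * sum (λ i → 𝔼 (λ x → φ x + ψ x) (t i))                  ≡⟨ cong (c *_) (sum-cong-≗ λ i → 𝔼-+ φ ψ (t i)) ⟩
  c * sum (λ i → 𝔼 φ (t i) + 𝔼 ψ (t i))                      ≡⟨ cong (c *_) (∑-distrib-+ (λ i → 𝔼 φ (t i)) (λ i → 𝔼 ψ (t i))) ⟩
  c * (sum (λ i → 𝔼 φ (t i)) + sum (λ i → 𝔼 ψ (t i)))        ≡⟨ ℚ.*-distribˡ-+ c _ _ ⟩
  c * sum (λ i → 𝔼 φ (t i)) + c * sum (λ i → 𝔼 ψ (t i))      ∎
  where open ≡-Reasoning
        c = ℤ.+ 1 / suc m

𝔼-* : ∀ p (φ : A → ℚ) (m : Rand A) → 𝔼 (λ x → p * φ x) m ≡ p * 𝔼 φ m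
𝔼-* p φ (return x) = refl
𝔼-* p φ (pick m t) = begin
  c * sum (λ i → 𝔼 (λ x → p * φ x) (t i))  ≡⟨ cong (c *_) (sum-cong-≗ λ i → 𝔼-* p φ (t i)) ⟩
  c * sum (λ i → p * 𝔼 φ (t i))            ≡⟨ cong (c *_) (*-distribˡ-sum p (λ i → 𝔼 φ (t i))) ⟨
  c * (p * S)                              ≡⟨ solve 3 (λ c p s → c :* (p :* s) := p :* (c :* s)) refl c p S ⟩
  p * (c * S)                              ∎
  where open ≡-Reasoning
        c = ℤ.+ 1 / suc m
        S = sum (λ i → 𝔼 φ (t i))

𝔼-sum : (φ : Fin n → A → ℚ) (m : Rand A) → 𝔼 (λ x → sum (λ i → φ i x)) m ≡ sum (λ i → 𝔼 (φ i) m)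
𝔼-sum {zero}  φ m = 𝔼-const 0ℚ m
𝔼-sum {suc n} φ m = trans (𝔼-+ (φ zero) (λ x → sum (λ i → φ (suc i) x)) m)
                          (cong (𝔼 (φ zero) m +_) (𝔼-sum (φ ∘ suc) m))

0≤𝔼 : {φ : A → ℚ} (m : Rand A) → (∀ x → 0ℚ ≤ φ x) → 0ℚ ≤ 𝔼 φ m
0≤𝔼 m 0≤φ = ≡-≤-trans (sym (𝔼-const 0ℚ m)) (𝔼-mono m (Always-all m 0≤φ) λ _ x → x)

𝔼-independently : (φ : A → ℚ) (f : Fin n → Rand A) (i : Fin n) →
                  𝔼 (λ x → φ (x i)) (independently f) ≡ 𝔼 φ (f i)
𝔼-independently {n = suc n} φ f zero = begin
  𝔼 (λ x → φ (x zero)) (independently f)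
    ≡⟨ 𝔼->>= _ (f zero) _ ⟩
  𝔼 (λ x → 𝔼 (λ y → φ (y zero)) (independently (f ∘ suc) >>= λ xs → return (x Vector.∷ xs))) (f zero)
    ≡⟨ 𝔼-cong (f zero) (λ x → trans (𝔼->>= _ (independently (f ∘ suc)) _) (𝔼-const (φ x) (independently (f ∘ suc)))) ⟩
  𝔼 φ (f zero) ∎
  where open ≡-Reasoning
𝔼-independently {n = suc n} φ f (suc i) = begin
  𝔼 (λ x → φ (x (suc i))) (independently f)
    ≡⟨ 𝔼->>= _ (f zero) _ ⟩
  𝔼 (λ x → 𝔼 (λ y → φ (y (suc i))) (independently (f ∘ suc) >>= λ xs → return (x Vector.∷ xs))) (f zero)
    ≡⟨ 𝔼-cong (f zero) (λ x → trans (𝔼->>= _ (independently (f ∘ suc)) _) (𝔼-independently φ (f ∘ suc) i)) ⟩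
  𝔼 (λ _ → 𝔼 φ (f (suc i))) (f zero)
    ≡⟨ 𝔼-const (𝔼 φ (f (suc i))) (f zero) ⟩
  𝔼 φ (f (suc i)) ∎
  where open ≡-Reasoning

-- Serves the two events behind a connection: the acceptor stays silent and the other endpoint
-- proposes to it. The coordinate drawn first factors out, the others average to a constant.
𝔼-independently₂ : (φ ψ : A → ℚ) (f : Fin n → Rand A) {i j : Fin n} → i ≢ j →
  𝔼 (λ x → φ (x i) * ψ (x j)) (independently f) ≡ 𝔼 φ (f i) * 𝔼 ψ (f j)
𝔼-independently₂ φ ψ f {zero}  {zero}  i≢j = contradiction refl i≢j
𝔼-independently₂ φ ψ f {zero}  {suc j} i≢j = begin
  𝔼 (λ x → φ (x zero) * ψ (x (suc j))) (independently f)
    ≡⟨ 𝔼->>= _ (f zero) _ ⟩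
  𝔼 (λ x → 𝔼 (λ y → φ (y zero) * ψ (y (suc j))) (independently (f ∘ suc) >>= λ xs → return (x Vector.∷ xs))) (f zero)
    ≡⟨ 𝔼-cong (f zero) (λ x → trans (𝔼->>= _ (independently (f ∘ suc)) _)
         (trans (𝔼-* (φ x) (λ xs → ψ (xs j)) (independently (f ∘ suc)))
           (trans (cong (φ x *_) (𝔼-independently ψ (f ∘ suc) j)) (ℚ.*-comm (φ x) _)))) ⟩
  𝔼 (λ x → 𝔼 ψ (f (suc j)) * φ x) (f zero)
    ≡⟨ 𝔼-* (𝔼 ψ (f (suc j))) φ (f zero) ⟩
  𝔼 ψ (f (suc j)) * 𝔼 φ (f zero)
    ≡⟨ ℚ.*-comm (𝔼 ψ (f (suc j))) (𝔼 φ (f zero)) ⟩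
  𝔼 φ (f zero) * 𝔼 ψ (f (suc j)) ∎
  where open ≡-Reasoning
𝔼-independently₂ φ ψ f {suc i} {zero}  i≢j = begin
  𝔼 (λ x → φ (x (suc i)) * ψ (x zero)) (independently f)
    ≡⟨ 𝔼-cong (independently f) (λ x → ℚ.*-comm (φ (x (suc i))) (ψ (x zero))) ⟩
  𝔼 (λ x → ψ (x zero) * φ (x (suc i))) (independently f)
    ≡⟨ 𝔼-independently₂ ψ φ f (λ ()) ⟩
  𝔼 ψ (f zero) * 𝔼 φ (f (suc i))
    ≡⟨ ℚ.*-comm (𝔼 ψ (f zero)) (𝔼 φ (f (suc i))) ⟩
  𝔼 φ (f (suc i)) * 𝔼 ψ (f zero) ∎
  where open ≡-Reasoning
𝔼-independently₂ {n = suc n} φ ψ f {suc i} {suc j} i≢j = begin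
  𝔼 (λ x → φ (x (suc i)) * ψ (x (suc j))) (independently f)
    ≡⟨ 𝔼->>= _ (f zero) _ ⟩
  𝔼 (λ x → 𝔼 (λ y → φ (y (suc i)) * ψ (y (suc j))) (independently (f ∘ suc) >>= λ xs → return (x Vector.∷ xs))) (f zero)
    ≡⟨ 𝔼-cong (f zero) (λ x → trans (𝔼->>= _ (independently (f ∘ suc)) _)
                                    (𝔼-independently₂ φ ψ (f ∘ suc) (i≢j ∘ cong suc))) ⟩
  𝔼 (λ _ → 𝔼 φ (f (suc i)) * 𝔼 ψ (f (suc j))) (f zero)
    ≡⟨ 𝔼-const _ (f zero) ⟩
  𝔼 φ (f (suc i)) * 𝔼 ψ (f (suc j)) ∎
  where open ≡-Reasoning

-- Expansion and cut edges

-- The parameters of a dynamic graph are compared only with the extrema of the single graphs. To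
-- compare them with a given set or node, each graph must be shown to attain its own extremum. The
-- second alternative, no candidate at all, lets the induction over finite unions start and
-- continue.
HasExtremum : Rel A 0ℓ → (A → Set) → Set
HasExtremum _≼_ P = ∃ (Extremum _≼_ P) ⊎ (∀ a → ¬ P a)

module _ {_≼_ : Rel A 0ℓ} (total : Total _≼_) (≼-trans : Transitive _≼_) where

  ≼-refl : ∀ {a} → a ≼ a
  ≼-refl {a} = Sum.reduce (total a a)

  hasExtremum-≡ : ∀ a → HasExtremum _≼_ (_≡ a)
  hasExtremum-≡ a = inj₁ (a , refl , λ { refl → ≼-refl })

  hasExtremum-⇔ : (∀ {a} → P a → Q a) → (∀ {a} → Q a → P a) → HasExtremum _≼_ P → HasExtremum _≼_ Q
  hasExtremum-⇔ f g (inj₁ (a , pa , least)) = inj₁ (a , f pa , least ∘ g)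
  hasExtremum-⇔ f g (inj₂ ¬P) = inj₂ λ a → ¬P a ∘ g

  hasExtremum-⊎ : HasExtremum _≼_ P → HasExtremum _≼_ Q → HasExtremum _≼_ (λ a → P a ⊎ Q a)
  hasExtremum-⊎ (inj₂ ¬P) (inj₂ ¬Q) = inj₂ λ a → Sum.[ ¬P a , ¬Q a ]
  hasExtremum-⊎ (inj₂ ¬P) (inj₁ (b , qb , lb)) =
    inj₁ (b , inj₂ qb , Sum.[ (λ pa → contradiction pa (¬P _)) , lb ])
  hasExtremum-⊎ (inj₁ (a , pa , la)) (inj₂ ¬Q) =
    inj₁ (a , inj₁ pa , Sum.[ la , (λ qb → contradiction qb (¬Q _)) ])
  hasExtremum-⊎ (inj₁ (a , pa , la)) (inj₁ (b , qb , lb)) with total a b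
  ... | inj₁ a≼b = inj₁ (a , inj₁ pa , Sum.[ la , (≼-trans a≼b ∘ lb) ])
  ... | inj₂ b≼a = inj₁ (b , inj₂ qb , Sum.[ (≼-trans b≼a ∘ la) , lb ])

  hasExtremum-Fin : {P : Fin n → A → Set} → (∀ i → HasExtremum _≼_ (P i)) → HasExtremum _≼_ (λ a → ∃[ i ] P i a)
  hasExtremum-Fin {zero}  h = inj₂ λ _ ()
  hasExtremum-Fin {suc n} h = hasExtremum-⇔
    Sum.[ (λ p → zero , p) , (λ (i , p) → suc i , p) ]
    (λ { (zero , p) → inj₁ p ; (suc i , p) → inj₂ (i , p) })
    (hasExtremum-⊎ (h zero) (hasExtremum-Fin (h ∘ suc)))

  hasExtremum-Subset : {P : Subset n → A → Set} → (∀ S → HasExtremum _≼_ (P S)) → HasExtremum _≼_ (λ a → ∃[ S ] P S a)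
  hasExtremum-Subset {zero}  h = hasExtremum-⇔ (λ p → [] , p) (λ { ([] , p) → p }) (h [])
  hasExtremum-Subset {suc n} h = hasExtremum-⇔
    Sum.[ (λ (S , p) → inside ∷ S , p) , (λ (S , p) → outside ∷ S , p) ]
    (λ { (inside ∷ S , p) → inj₁ (S , p) ; (outside ∷ S , p) → inj₂ (S , p) })
    (hasExtremum-⊎ (hasExtremum-Subset (h ∘ (inside ∷_))) (hasExtremum-Subset (h ∘ (outside ∷_))))

∈-tabulate⁺ : (P? : Decidable {A = Fin n} P) → ∀ {i} → P i → i ∈ tabulate (does ∘ P?)
∈-tabulate⁺ P? {i} p = lookup⇒[]= i _ (trans (lookup∘tabulate (does ∘ P?) i) (dec-true (P? i) p))

∈-tabulate⁻ : (P? : Decidable {A = Fin n} P) → ∀ {i} → i ∈ tabulate (does ∘ P?) → P i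
∈-tabulate⁻ P? {i} i∈ with P? i | trans (sym (lookup∘tabulate (does ∘ P?) i)) ([]=⇒lookup i∈)
... | yes p | _ = p

-- Stated for an arbitrary `g` because the recursion passes to `g ∘ suc`.
length-filter-tabulate : (P? : Decidable P) (g : Fin n → A) (S : Subset n) →
  (∀ i → P (g i) → i ∈ S) → length (filter P? (List.tabulate g)) ℕ.≤ ∣ S ∣
length-filter-tabulate P? g [] P⊆S = z≤n
length-filter-tabulate P? g (s ∷ S) P⊆S
  with P? (g zero) | length-filter-tabulate P? (g ∘ suc) S (λ i p → drop (P⊆S (suc i) p))
  where
  drop : ∀ {i} → suc i ∈ s ∷ S → i ∈ S
  drop (there i∈) = i∈
... | no _  | ih = ℕ.≤-trans ih (∣S∣≤ s)
  where
  ∣S∣≤ : ∀ s → ∣ S ∣ ℕ.≤ ∣ s ∷ S ∣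
  ∣S∣≤ outside = ℕ.≤-refl
  ∣S∣≤ inside  = ℕ.n≤1+n ∣ S ∣
... | yes p | ih with here ← P⊆S zero p = s≤s ih

card-sum : (S : Subset n) → fromℕ ∣ S ∣ ≡ sum (λ i → 𝟙 (i ∈? S))
card-sum []            = refl
card-sum (inside ∷ S)  = trans (fromℕ-suc ∣ S ∣) (cong (1ℚ +_) (card-sum S))
card-sum (outside ∷ S) = trans (card-sum S) (sym (ℚ.+-identityˡ _))

∣p∣+∣∁p∣≡n : (S : Subset n) → ∣ S ∣ ℕ.+ ∣ ∁ S ∣ ≡ n
∣p∣+∣∁p∣≡n S = trans (cong (∣ S ∣ ℕ.+_) (∣∁p∣≡n∸∣p∣ S)) (ℕ.m+[n∸m]≡n (∣p∣≤n S))

module _ (G : Graph n) where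
  open Graph G

  maxDegree-exists : Fin n → ∃ IsMaxDegree
  maxDegree-exists u = Sum.[ id , (λ ¬d → contradiction (u , refl) (¬d (degree u))) ]′
    (hasExtremum-Fin (flip ℕ.≤-total) (flip ℕ.≤-trans)
      (λ u → hasExtremum-≡ (flip ℕ.≤-total) (flip ℕ.≤-trans) (degree u)))

  -- The part of `IsExpansion` that concerns one set `S`, split off so that the extremum can be
  -- sought set by set.
  Ratio : Subset n → ℚ → Set
  Ratio S q = Σ[ S≢∅ ∈ NonZero ∣ S ∣ ] 2 ℕ.* ∣ S ∣ ℕ.≤ n × q ≡ (ℤ.+ ∣ ∂ S ∣ / ∣ S ∣) {{S≢∅}}

  private
    hasExtremum-Ratio : ∀ S → Dec (NonZero ∣ S ∣) → Dec (2 ℕ.* ∣ S ∣ ℕ.≤ n) →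
                        HasExtremum ℚ._≤_ (Ratio S)
    hasExtremum-Ratio S (no S≡∅)  _        = inj₂ λ _ (S≢∅ , _) → S≡∅ S≢∅
    hasExtremum-Ratio S (yes _)   (no ≰n)  = inj₂ λ _ (_ , ≤n , _) → ≰n ≤n
    hasExtremum-Ratio S (yes S≢∅) (yes ≤n) = inj₁ (_ , (S≢∅ , ≤n , refl) , λ { (_ , _ , refl) → ℚ.≤-refl })

  -- With `2 ≤ n` a singleton is at most half of the nodes. It shows that the expansion has a
  -- candidate, and later that α is at most Δ.
  singleton-ratio : 2 ℕ.≤ n → ∀ u → ∃[ q ] q ≤ fromℕ (degree u) × Ratio ⁅ u ⁆ q
  singleton-ratio 2≤n u = q , q≤ , nz , subst (λ m → 2 ℕ.* m ℕ.≤ n) (sym (∣⁅x⁆∣≡1 u)) 2≤n , refl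
    where
    instance nz : NonZero ∣ ⁅ u ⁆ ∣
             nz = subst NonZero (sym (∣⁅x⁆∣≡1 u)) _
    q : ℚ
    q = ℤ.+ ∣ ∂ ⁅ u ⁆ ∣ / ∣ ⁅ u ⁆ ∣
    ∂⊆nbrs : ∂ ⁅ u ⁆ ⊆ nbrs u
    ∂⊆nbrs {v} v∈∂ with _ , w , w∈ , w∈nbrs ← ∈-tabulate⁻ (inBoundary? ⁅ u ⁆) v∈∂ =
      symmetric (subst (_∈ nbrs v) (x∈⁅y⁆⇒x≡y u w∈) w∈nbrs)
    open ℚ.≤-Reasoning
    q≤ : q ≤ fromℕ (degree u)
    q≤ = begin
      q                      ≡⟨ ℚ.*-identityʳ q ⟨
      q * fromℕ 1            ≡⟨ cong (λ m → q * fromℕ m) (∣⁅x⁆∣≡1 u) ⟨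
      q * fromℕ ∣ ⁅ u ⁆ ∣    ≡⟨ /-* ∣ ∂ ⁅ u ⁆ ∣ ∣ ⁅ u ⁆ ∣ ⟩
      fromℕ ∣ ∂ ⁅ u ⁆ ∣      ≤⟨ fromℕ-mono (p⊆q⇒∣p∣≤∣q∣ ∂⊆nbrs) ⟩
      fromℕ (degree u)       ∎

  expansion-exists : 2 ℕ.≤ n → Fin n → ∃ IsExpansion
  expansion-exists 2≤n u = Sum.[ id , (λ ¬α → let q , _ , ratio = singleton-ratio 2≤n u in
                                              contradiction (⁅ u ⁆ , ratio) (¬α q)) ]′
    (hasExtremum-Subset ℚ.≤-total ℚ.≤-trans λ S →
      hasExtremum-Ratio S (ℕ.nonZero? ∣ S ∣) (2 ℕ.* ∣ S ∣ ℕ.≤? n))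

  IsCut : Subset n → Fin n → Fin n → Set
  IsCut S u v = u ∈ S × v ∉ S × u ∈ nbrs v

  isCut? : ∀ S u v → Dec (IsCut S u v)
  isCut? S u v = (u ∈? S) ×-dec (¬? (v ∈? S) ×-dec (u ∈? nbrs v))

  -- Edges are counted rather than boundary nodes: one number then dominates the boundary of `S` and
  -- that of its complement, and expectations add up over edges.
  cut : Subset n → ℚ
  cut S = sum λ v → sum λ u → 𝟙 (isCut? S u v)

  private
    0≤cut : ∀ S → 0ℚ ≤ cut S
    0≤cut S = 0≤sum λ v → 0≤sum λ u → 0≤𝟙 (isCut? S u v)

  ∂≤cut : ∀ S → fromℕ ∣ ∂ S ∣ ≤ cut S
  ∂≤cut S = ≡-≤-trans (card-sum (∂ S)) (sum-mono λ v →
    𝟙-lower (v ∈? ∂ S) (0≤sum λ u → 0≤𝟙 (isCut? S u v)) λ v∈∂ →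
      let v∉S , u , u∈S , u∈nbrs = ∈-tabulate⁻ (inBoundary? S) v∈∂ in
      ≡-≤-trans (sym (𝟙-true (isCut? S u v) (u∈S , v∉S , u∈nbrs)))
                (term≤sum (λ u → 0≤𝟙 (isCut? S u v)) u))

  ∂∁≤cut : ∀ S → fromℕ ∣ ∂ (∁ S) ∣ ≤ cut S
  ∂∁≤cut S = ≡-≤-trans (card-sum (∂ (∁ S))) (≤-≡-trans (sum-mono λ u →
    𝟙-lower (u ∈? ∂ (∁ S)) (0≤sum λ v → 0≤𝟙 (isCut? S u v)) λ u∈∂ →
      let u∉∁S , v , v∈∁S , v∈nbrs = ∈-tabulate⁻ (inBoundary? (∁ S)) u∈∂ in
      ≡-≤-trans (sym (𝟙-true (isCut? S u v) (x∉∁p⇒x∈p u∉∁S , x∈∁p⇒x∉p v∈∁S , symmetric v∈nbrs)))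
                (term≤sum (λ v → 0≤𝟙 (isCut? S u v)) v))
    (∑-comm λ u v → 𝟙 (isCut? S u v)))

  module _ {α : ℚ} (0≤α : 0ℚ ≤ α) (α-least : ∀ {q} → (∃[ S ] Ratio S q) → α ≤ q) where

    expansion-∂ : ∀ S → 2 ℕ.* ∣ S ∣ ℕ.≤ n → α * fromℕ ∣ S ∣ ≤ fromℕ ∣ ∂ S ∣
    expansion-∂ S ≤n = by-size (ℕ.nonZero? ∣ S ∣)
      where
      by-size : Dec (NonZero ∣ S ∣) → α * fromℕ ∣ S ∣ ≤ fromℕ ∣ ∂ S ∣
      by-size (yes S≢∅) = ≤-≡-trans
        (*-monoˡ (0≤fromℕ ∣ S ∣) (α-least (S , S≢∅ , ≤n , refl))) (/-* ∣ ∂ S ∣ ∣ S ∣ {{S≢∅}})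
      by-size (no S≡∅) = ≡-≤-trans
        (trans (cong (λ m → α * fromℕ m) (nonZero-stable S≡∅)) (ℚ.*-zeroʳ α)) (0≤fromℕ ∣ ∂ S ∣)
        where
        nonZero-stable : ∀ {m} → ¬ NonZero m → m ≡ 0
        nonZero-stable {zero}  _  = refl
        nonZero-stable {suc m} ¬p = contradiction _ ¬p

    -- One of `S` and `∁ S` is at most half of the nodes and expands by α; the other has at most n
    -- nodes. With the product of the sizes in place of their minimum, later steps need no case
    -- distinction.
    expansion-cut : ∀ S → α * (fromℕ ∣ S ∣ * fromℕ ∣ ∁ S ∣) ≤ fromℕ n * cut S
    expansion-cut S = Sum.[ small , large ]′ (ℕ.≤-total (2 ℕ.* ∣ S ∣) n)
      where
      open ℚ.≤-Reasoning
      s c : ℚ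
      s = fromℕ ∣ S ∣
      c = fromℕ ∣ ∁ S ∣
      c≤n : c ≤ fromℕ n
      c≤n = fromℕ-mono (∣p∣≤n (∁ S))
      s≤n : s ≤ fromℕ n
      s≤n = fromℕ-mono (∣p∣≤n S)
      small : 2 ℕ.* ∣ S ∣ ℕ.≤ n → α * (s * c) ≤ fromℕ n * cut S
      small ≤n = begin
        α * (s * c)        ≡⟨ solve 3 (λ a s c → a :* (s :* c) := c :* (a :* s)) refl α s c ⟩
        c * (α * s)        ≤⟨ *-mono (0≤fromℕ ∣ ∁ S ∣) (0≤cut S) c≤n (ℚ.≤-trans (expansion-∂ S ≤n) (∂≤cut S)) ⟩
        fromℕ n * cut S    ∎
      large : n ℕ.≤ 2 ℕ.* ∣ S ∣ → α * (s * c) ≤ fromℕ n * cut S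
      large n≤ = begin
        α * (s * c)        ≡⟨ solve 3 (λ a s c → a :* (s :* c) := s :* (a :* c)) refl α s c ⟩
        s * (α * c)        ≤⟨ *-mono (0≤fromℕ ∣ S ∣) (0≤cut S) s≤n (ℚ.≤-trans (expansion-∂ (∁ S) ≤n) (∂∁≤cut S)) ⟩
        fromℕ n * cut S    ∎
        where
        ≤n : 2 ℕ.* ∣ ∁ S ∣ ℕ.≤ n
        ≤n = subst₂ ℕ._≤_
          (cong (∣ ∁ S ∣ ℕ.+_) (sym (ℕ.+-identityʳ ∣ ∁ S ∣)))
          (∣p∣+∣∁p∣≡n S)
          (ℕ.+-monoˡ-≤ ∣ ∁ S ∣ (ℕ.+-cancelˡ-≤ ∣ S ∣ _ _
            (subst₂ ℕ._≤_ (sym (∣p∣+∣∁p∣≡n S)) (cong (∣ S ∣ ℕ.+_) (ℕ.+-identityʳ ∣ S ∣)) n≤)))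

-- One round of BlindMatch

open Graph using (nbrs; symmetric; irreflexive; degree)

-- The events exclude each other, so at most one summand is 1.
sum-unique≤ : {P : Fin n → Set} {Q : Set} (P? : Decidable P) (Q? : Dec Q) →
  (∀ {i j} → P i → P j → i ≡ j) → (∀ {i} → P i → Q) → sum (λ i → 𝟙 (P? i)) ≤ 𝟙 Q?
sum-unique≤ {n} P? Q? unique P⇒Q = by (Fin.any? P?)
  where
  by : Dec (∃ _) → sum (λ i → 𝟙 (P? i)) ≤ 𝟙 Q?
  by (yes (i , pi)) = sum-single≤ {i = i}
    (λ j j≢i → 𝟙-lower (P? j) ℚ.≤-refl (λ pj → contradiction (unique pj pi) j≢i))
    (𝟙-mono (P? i) Q? P⇒Q)
  by (no ¬p) = ℚ.≤-trans
    (≤-≡-trans (sum-mono λ i → 𝟙-lower (P? i) ℚ.≤-refl λ pi → contradiction (i , pi) ¬p)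
               (sum-replicate-zero n))
    (0≤𝟙 Q?)

_≟ᴹ_ : (x y : Maybe (Fin n)) → Dec (x ≡ y)
_≟ᴹ_ = ≡-dec Fin._≟_

Always-uniform : (l : List A) → Always (λ x → ∀ {y} → x ≡ just y → y ∈ˡ l) (uniform l)
Always-uniform []      ()
Always-uniform (x ∷ l) i refl = ∈-lookup i

-- One bound for both uniform choices in a round, that of a neighbor and that of a proposal.
-- Membership excludes the empty list, and `c` stands for 1/d without a division.
Pr-uniform : ∀ {c d} (l : List (Fin n)) {x} → x ∈ˡ l → length l ℕ.≤ d →
             0ℚ ≤ c → c * fromℕ d ≤ 1ℚ → c ≤ 𝔼 (λ y → 𝟙 (y ≟ᴹ just x)) (uniform l)
Pr-uniform {c = c} {d} l@(y ∷ ys) {x} x∈l l≤d 0≤c cd≤1 = begin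
  c                                   ≡⟨ sample-mean m c ⟨
  (ℤ.+ 1 / suc m) * (fromℕ (suc m) * c)  ≡⟨ cong ((ℤ.+ 1 / suc m) *_) (ℚ.*-comm (fromℕ (suc m)) c) ⟩
  (ℤ.+ 1 / suc m) * (c * fromℕ (suc m))  ≤⟨ *-monoʳ (0≤1/ (suc m)) (ℚ.≤-trans (*-monoʳ 0≤c (fromℕ-mono l≤d)) cd≤1) ⟩
  (ℤ.+ 1 / suc m) * 1ℚ                   ≤⟨ *-monoʳ (0≤1/ (suc m)) (≡-≤-trans
                                           (sym (𝟙-true (hit (index x∈l)) (cong just (sym (lookup-index x∈l)))))
                                           (term≤sum (λ i → 0≤𝟙 (hit i)) (index x∈l))) ⟩
  𝔼 (λ y → 𝟙 (y ≟ᴹ just x)) (uniform l)  ∎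
  where
  open ℚ.≤-Reasoning
  m : ℕ
  m = length ys
  hit : ∀ i → Dec (just (List.lookup l i) ≡ just x)
  hit i = just (List.lookup l i) ≟ᴹ just x

Always-blindPropose : (S : Subset n) → Always (λ x → ∀ {v} → x ≡ just v → v ∈ S) (blindPropose S)
Always-blindPropose S zero    = Always-map (uniform l)
  (λ _ v∈l {_} eq → proj₂ (∈-filter⁻ (_∈? S) {xs = allFin _} (v∈l eq))) (Always-uniform l)
  where l = filter (_∈? S) (allFin _)
Always-blindPropose S (suc _) ()

Pr-blindPropose-just : ∀ {c d} (S : Subset n) {v} → v ∈ S → ∣ S ∣ ℕ.≤ d → 0ℚ ≤ c → c * fromℕ d ≤ 1ℚ →
  ½ * c ≤ 𝔼 (λ x → 𝟙 (x ≟ᴹ just v)) (blindPropose S)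
Pr-blindPropose-just S {v} v∈S S≤d 0≤c cd≤1 = *-monoʳ 0≤½ (≤-by-gap-trans
  (Pr-uniform (filter (_∈? S) (allFin _)) (∈-filter⁺ (_∈? S) (∈-allFin v) v∈S)
    (ℕ.≤-trans (length-filter-tabulate (_∈? S) id S (λ _ x → x)) S≤d) 0≤c cd≤1))
  where
  -- The two zeros are the receiver's branch of the coin, which never proposes, and the empty tail
  -- of the sum.
  ≤-by-gap-trans : ∀ {p q} → p ≤ q → p ≤ q + (0ℚ + 0ℚ)
  ≤-by-gap-trans {_} {q} p≤q = ≤-≡-trans p≤q (sym (ℚ.+-identityʳ q))

Pr-blindPropose-nothing : (S : Subset n) → ½ ≤ 𝔼 (λ x → 𝟙 (x ≟ᴹ nothing)) (blindPropose S)
Pr-blindPropose-nothing S = *-monoʳ {p = 1ℚ} {q = Pr-send + (1ℚ + 0ℚ)} 0≤½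
  (≤-by-gap (0≤𝔼 (uniform l) (λ x → 0≤𝟙 (x ≟ᴹ nothing))) (ℚ.+-comm Pr-send 1ℚ))
  where
  l = filter (_∈? S) (allFin _)
  Pr-send : ℚ
  Pr-send = 𝔼 (λ x → 𝟙 (x ≟ᴹ nothing)) (uniform l)

-- Knowers of a token and the possible outcomes of a round

knowers : Fin N → Knowledge n N → Subset n
knowers t T = tabulate λ u → does (t ∈? T u)

module _ (t : Fin N) (T : Knowledge n N) where

  ∈-knowers⁺ : ∀ {u} → t ∈ T u → u ∈ knowers t T
  ∈-knowers⁺ = ∈-tabulate⁺ (λ u → t ∈? T u)

  ∈-knowers⁻ : ∀ {u} → u ∈ knowers t T → t ∈ T u
  ∈-knowers⁻ = ∈-tabulate⁻ (λ u → t ∈? T u)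

module _ (nodes : Nodes n N) (G : Graph n) (transfer : Transfer N ε) (T : Knowledge n N) where

  open Transfer transfer
  open Round nodes G blindPropose run

  Results : Set
  Results = Fin n → Subset N × Subset N

  Gains : Fin n → Fin n → Subset N × Subset N → Set
  Gains u v (Tᵤ′ , Tᵥ′) = (T u ⊆ Tᵤ′ × Tᵤ′ ⊆ T u ∪ T v) × (T v ⊆ Tᵥ′ × Tᵥ′ ⊆ T u ∪ T v)

  -- Pathwise facts about a possible outcome, so that inequalities between counts need not unfold
  -- the random stages.
  record ValidRound (proposal accepted : Choices) (result : Results) : Set where
    field
      proposal-edge   : ∀ {u v} → proposal u ≡ just v → v ∈ nbrs G u
      acceptor-silent : ∀ {u v} → accepted v ≡ just u → proposal v ≡ nothing
      accepted-sent   : ∀ {u v} → accepted v ≡ just u → proposal u ≡ just v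
      gains           : ∀ {u v} → accepted v ≡ just u → Gains u v (result v)
      idle            : ∀ {v} → accepted v ≡ nothing → result v ≡ (T v , T v)

  private
    ValidProposal : Choices → Set
    ValidProposal proposal = ∀ u {v} → proposal u ≡ just v → v ∈ nbrs G u

    ValidAcceptance : Choices → Choices → Set
    ValidAcceptance proposal accepted =
      ∀ v {u} → accepted v ≡ just u → proposal v ≡ nothing × proposal u ≡ just v

    ValidResult : Choices → Results → Set
    ValidResult accepted result = ∀ v →
      (∀ {u} → accepted v ≡ just u → Gains u v (result v)) ×
      (accepted v ≡ nothing → result v ≡ (T v , T v))

    proposals : Rand Choices
    proposals = independently λ u → blindPropose (nbrs G u)

    always-proposals : Always ValidProposal proposals
    always-proposals = Always-independently λ u → Always-blindPropose (nbrs G u)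

    always-accept : ∀ proposal → Always (ValidAcceptance proposal) (independently (accept proposal))
    always-accept proposal = Always-independently one
      where
      one : ∀ v → Always (λ x → ∀ {u} → x ≡ just u → proposal v ≡ nothing × proposal u ≡ just v)
                         (accept proposal v)
      one v with proposal v
      ... | just _  = λ ()
      ... | nothing = Always-map (uniform (proposersTo proposal v))
        (λ _ u∈ {_} eq → refl , proj₂ (∈-filter⁻ (λ u → ≡-dec Fin._≟_ (proposal u) (just v)) {xs = allFin n} (u∈ eq)))
        (Always-uniform (proposersTo proposal v))

    edge-≢ : ∀ {u v} → v ∈ nbrs G u → Nodes.id nodes u ≢ Nodes.id nodes v
    edge-≢ v∈ eq with refl ← Nodes.id-injective nodes eq = irreflexive G v∈

    always-connect : ∀ {proposal accepted} → ValidProposal proposal → ValidAcceptance proposal accepted →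
      Always (ValidResult accepted) (independently (connect T accepted))
    always-connect {proposal} {accepted} vp va = Always-independently one
      where
      one : ∀ v → Always (λ x → (∀ {u} → accepted v ≡ just u → Gains u v x) ×
                                (accepted v ≡ nothing → x ≡ (T v , T v)))
                         (connect T accepted v)
      one v with accepted v in eq
      ... | just u  = Always-map (run _ _ (T u) (T v)) (λ _ g → (λ { {_} refl → g }) , λ ())
                        (gains-only (edge-≢ (vp u (proj₂ (va v eq)))) (T u) (T v))
      ... | nothing = (λ ()) , (λ _ → refl)

    valid : ∀ {proposal accepted result} → ValidProposal proposal → ValidAcceptance proposal accepted →
            ValidResult accepted result → ValidRound proposal accepted result
    valid vp va vr = record
      { proposal-edge   = vp _
      ; acceptor-silent = proj₁ ∘ va _
      ; accepted-sent   = proj₂ ∘ va _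
      ; gains           = proj₁ (vr _)
      ; idle            = proj₂ (vr _)
      }

  -- Keeps proposals, acceptances and results visible; `round` returns only the final knowledge,
  -- which does not tell who informed whom.
  𝔼³ : (Choices → Choices → Results → ℚ) → ℚ
  𝔼³ ψ = 𝔼 (λ p → 𝔼 (λ a → 𝔼 (ψ p a) (independently (connect T a))) (independently (accept p))) proposals

  Always-round : {P : Knowledge n N → Set} →
    (∀ {p a r} → ValidRound p a r → P (update T p a r)) → Always P (round T)
  Always-round f =
    Always->>= proposals always-proposals λ p vp →
    Always->>= (independently (accept p)) (always-accept p) λ a va →
    Always->>= (independently (connect T a)) (always-connect vp va) λ r vr →
    f (valid vp va vr)

  𝔼-round : (φ : Knowledge n N → ℚ) → 𝔼 φ (round T) ≡ 𝔼³ (λ p a r → φ (update T p a r))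
  𝔼-round φ =
    trans (𝔼->>= φ proposals _) (𝔼-cong proposals λ p →
    trans (𝔼->>= φ (independently (accept p)) _) (𝔼-cong (independently (accept p)) λ a →
    𝔼->>= φ (independently (connect T a)) _))

  𝔼³-mono : ∀ {φ ψ} → (∀ {p a r} → ValidRound p a r → φ p a r ≤ ψ p a r) → 𝔼³ φ ≤ 𝔼³ ψ
  𝔼³-mono φ≤ψ =
    𝔼-mono proposals always-proposals λ p vp →
    𝔼-mono (independently (accept p)) (always-accept p) λ a va →
    𝔼-mono (independently (connect T a)) (always-connect vp va) λ r vr →
    φ≤ψ (valid vp va vr)

  𝔼³-const : ∀ p → 𝔼³ (λ _ _ _ → p) ≡ p
  𝔼³-const q =
    trans (𝔼-cong proposals λ p →
      trans (𝔼-cong (independently (accept p)) λ a → 𝔼-const q (independently (connect T a)))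
            (𝔼-const q (independently (accept p))))
      (𝔼-const q proposals)

  𝔼³-+ : ∀ φ ψ → 𝔼³ (λ p a r → φ p a r + ψ p a r) ≡ 𝔼³ φ + 𝔼³ ψ
  𝔼³-+ φ ψ = trans
    (𝔼-cong proposals λ p → trans
      (𝔼-cong (independently (accept p)) λ a → 𝔼-+ (φ p a) (ψ p a) (independently (connect T a)))
      (𝔼-+ _ _ (independently (accept p))))
    (𝔼-+ _ _ proposals)

  𝔼³-* : ∀ q ψ → 𝔼³ (λ p a r → q * ψ p a r) ≡ q * 𝔼³ ψ
  𝔼³-* q ψ = trans
    (𝔼-cong proposals λ p → trans
      (𝔼-cong (independently (accept p)) λ a → 𝔼-* q (ψ p a) (independently (connect T a)))
      (𝔼-* q _ (independently (accept p))))
    (𝔼-* q _ proposals)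

  𝔼³-sum : ∀ {m} (ψ : Fin m → Choices → Choices → Results → ℚ) →
           𝔼³ (λ p a r → sum (λ i → ψ i p a r)) ≡ sum (λ i → 𝔼³ (ψ i))
  𝔼³-sum ψ = trans
    (𝔼-cong proposals λ p → trans
      (𝔼-cong (independently (accept p)) λ a → 𝔼-sum (λ i → ψ i p a) (independently (connect T a)))
      (𝔼-sum (λ i a → 𝔼 (ψ i p a) (independently (connect T a))) (independently (accept p))))
    (𝔼-sum (λ i p → 𝔼 (λ a → 𝔼 (ψ i p a) (independently (connect T a))) (independently (accept p))) proposals)

  Grows : Knowledge n N → Set
  Grows T′ = ∀ w → T w ⊆ T′ w × (∀ {x} → x ∈ T′ w → ∃[ u ] x ∈ T u)

  module _ {p a r} (valid-round : ValidRound p a r) where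
    open ValidRound valid-round

    private
      known : ∀ {u v x} → x ∈ T u ∪ T v → ∃[ w ] x ∈ T w
      known {u} {v} x∈ = Sum.[ (λ x∈u → u , x∈u) , (λ x∈v → v , x∈v) ]′ (x∈p∪q⁻ (T u) (T v) x∈)

    update-grows : Grows (update T p a r)
    update-grows w with p w in pw
    ... | nothing with a w in aw
    ...   | just u  = let _ , old , new = gains aw in old , λ x∈ → known (new x∈)
    ...   | nothing rewrite idle aw = (λ x∈ → x∈) , λ x∈ → w , x∈
    update-grows w | just v with ≡-dec Fin._≟_ (a v) (just w)
    ...   | yes av = let (old , new) , _ = gains av in old , λ x∈ → known (new x∈)
    ...   | no _   = (λ x∈ → x∈) , λ x∈ → w , x∈

    update-acceptor : ∀ {u w} → a w ≡ just u → update T p a r w ≡ proj₂ (r w)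
    update-acceptor {u} {w} aw rewrite acceptor-silent aw = refl

  module _ (t : Fin N) where

    Informs : Choices → Results → Fin n → Fin n → Set
    Informs a r u v = u ∈ knowers t T × v ∉ knowers t T × a v ≡ just u × t ∈ proj₂ (r v)

    informs? : ∀ a r u v → Dec (Informs a r u v)
    informs? a r u v = (u ∈? knowers t T) ×-dec ¬? (v ∈? knowers t T) ×-dec (a v ≟ᴹ just u) ×-dec (t ∈? proj₂ (r v))

    informed : Choices → Choices → Results → ℚ
    informed p a r = sum λ v → sum λ u → 𝟙 (informs? a r u v)

    0≤informed : ∀ p a r → 0ℚ ≤ informed p a r
    0≤informed p a r = 0≤sum λ v → 0≤sum λ u → 0≤𝟙 (informs? a r u v)

    module _ {p a r} (valid-round : ValidRound p a r) where
      open ValidRound valid-round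

      -- A proposer has a single target, so a knower informs at most one node. This keeps the
      -- counted increase within the range where 1/s may be linearized.
      informed≤knowers : informed p a r ≤ fromℕ ∣ knowers t T ∣
      informed≤knowers = begin
        informed p a r                                ≡⟨ ∑-comm (λ v u → 𝟙 (informs? a r u v)) ⟩
        sum (λ u → sum λ v → 𝟙 (informs? a r u v))    ≤⟨ sum-mono (λ u → sum-unique≤ (informs? a r u) (u ∈? knowers t T)
                                                          (λ (_ , _ , a₁ , _) (_ , _ , a₂ , _) →
                                                            just-injective (trans (sym (accepted-sent a₁)) (accepted-sent a₂)))
                                                          proj₁) ⟩
        sum (λ u → 𝟙 (u ∈? knowers t T))                        ≡⟨ card-sum (knowers t T) ⟨
        fromℕ ∣ knowers t T ∣                                   ∎
        where open ℚ.≤-Reasoning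

      -- Old knowers keep the token, and an ignorant node accepts from one proposer only, so its
      -- inner sum is at most 1. Equality can fail, as an ignorant proposer may learn the token too.
      knowers+informed≤ : fromℕ ∣ knowers t T ∣ + informed p a r ≤ fromℕ ∣ knowers t (update T p a r) ∣
      knowers+informed≤ = begin
        fromℕ ∣ knowers t T ∣ + informed p a r
          ≡⟨ cong (_+ informed p a r) (card-sum (knowers t T)) ⟩
        sum (λ v → 𝟙 (v ∈? knowers t T)) + informed p a r
          ≡⟨ ∑-distrib-+ (λ v → 𝟙 (v ∈? knowers t T)) (λ v → sum λ u → 𝟙 (informs? a r u v)) ⟨
        sum (λ v → 𝟙 (v ∈? knowers t T) + sum (λ u → 𝟙 (informs? a r u v)))
          ≤⟨ sum-mono (λ v → each v (v ∈? knowers t T)) ⟩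
        sum (λ v → 𝟙 (v ∈? S′))
          ≡⟨ card-sum S′ ⟨
        fromℕ ∣ S′ ∣ ∎
        where
        open ℚ.≤-Reasoning
        S′ : Subset n
        S′ = knowers t (update T p a r)
        each : ∀ v (v∈? : Dec (v ∈ knowers t T)) → 𝟙 v∈? + sum (λ u → 𝟙 (informs? a r u v)) ≤ 𝟙 (v ∈? S′)
        each v (yes v∈S) = begin
          1ℚ + sum (λ u → 𝟙 (informs? a r u v))
            ≤⟨ ℚ.+-monoʳ-≤ 1ℚ (sum-mono λ u → 𝟙-lower (informs? a r u v) ℚ.≤-refl
                 λ (_ , v∉S , _) → contradiction v∈S v∉S) ⟩
          1ℚ + sum {n} (λ u → 0ℚ)
            ≡⟨ cong (1ℚ +_) (sum-replicate-zero n) ⟩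
          1ℚ
            ≡⟨ 𝟙-true (v ∈? S′) (∈-knowers⁺ t (update T p a r) (proj₁ (update-grows valid-round v) (∈-knowers⁻ t T v∈S))) ⟨
          𝟙 (v ∈? S′) ∎
        each v (no v∉S) = ≡-≤-trans (ℚ.+-identityˡ _) (sum-unique≤ (λ u → informs? a r u v) (v ∈? S′)
          (λ (_ , _ , a₁ , _) (_ , _ , a₂ , _) → just-injective (trans (sym a₁) a₂))
          (λ (_ , _ , av , t∈) → ∈-knowers⁺ t (update T p a r) (subst (t ∈_) (sym (update-acceptor valid-round av)) t∈)))

-- Probability that the token crosses a cut edge

x∈p─q⇒x∉q : ∀ (p q : Subset n) {x} → x ∈ p ─ q → x ∉ q
x∈p─q⇒x∉q (inside  ∷ p) (inside ∷ q) () here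
x∈p─q⇒x∉q (outside ∷ p) (inside ∷ q) () here
x∈p─q⇒x∉q (_ ∷ p) (_ ∷ q) (there x∈) (there x∈q) = x∈p─q⇒x∉q p q x∈ x∈q

module _ (nodes : Nodes n N) (G : Graph n) (transfer : Transfer N ε) (T : Knowledge n N) (t : Fin N)
         (½≤1-ε : ½ ≤ 1ℚ - ε)
         (smaller-known : ∀ {x u} → x ∈ T u → x Fin.< t → ∀ v → x ∈ T v)
         {d : ℕ} (degree≤d : ∀ u → degree G u ℕ.≤ d) {c : ℚ} (0≤c : 0ℚ ≤ c) (cd≤1 : c * fromℕ d ≤ 1ℚ) where

  open Transfer transfer
  open Round nodes G blindPropose run

  private
    S : Subset n
    S = knowers t T

    module _ {u v : Fin n} (u∈S : u ∈ S) (v∉S : v ∉ S) where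

      u≢v : u ≢ v
      u≢v refl = v∉S u∈S

      -- A smaller token held by `u` or `v` is known everywhere, hence lies in the intersection.
      t-smallest : Extremum Fin._≤_ (_∈ (T u ∪ T v) ─ (T u ∩ T v)) t
      t-smallest =
        x∈p∧x∉q⇒x∈p─q (x∈p∪q⁺ (inj₁ (∈-knowers⁻ t T u∈S)))
          (λ t∈∩ → v∉S (∈-knowers⁺ t T (proj₂ (x∈p∩q⁻ (T u) (T v) t∈∩)))) ,
        λ {b} b∈ → ℕ.≮⇒≥ λ b<t →
          let known = Sum.[ (λ b∈u → smaller-known b∈u b<t) , (λ b∈v → smaller-known b∈v b<t) ]′
                        (x∈p∪q⁻ (T u) (T v) (p─q⊆p (T u ∪ T v) (T u ∩ T v) b∈))
          in x∈p─q⇒x∉q (T u ∪ T v) (T u ∩ T v) b∈ (x∈p∩q⁺ (known u , known v))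

      connect-just : ∀ (a : Choices) → a v ≡ just u → connect T a v ≡ run (Nodes.id nodes u) (Nodes.id nodes v) (T u) (T v)
      connect-just a av rewrite av = refl

      accept-nothing : ∀ (p : Choices) → p v ≡ nothing → accept p v ≡ uniform (proposersTo p v)
      accept-nothing p pv rewrite pv = refl

      -- Once `v` has accepted `u`, only the private randomness of `Transfer` is left, and its
      -- success puts the token into the acceptor's set.
      informs-by-transfer : ∀ a → ½ * 𝟙 (a v ≟ᴹ just u) ≤
        𝔼 (λ r → 𝟙 (informs? nodes G transfer T t a r u v)) (independently (connect T a))
      informs-by-transfer a = by (a v ≟ᴹ just u)
        where
        open ℚ.≤-Reasoning
        by : (av? : Dec (a v ≡ just u)) → ½ * 𝟙 av? ≤
             𝔼 (λ r → 𝟙 (informs? nodes G transfer T t a r u v)) (independently (connect T a))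
        by (no _) = ≡-≤-trans (ℚ.*-zeroʳ ½)
          (0≤𝔼 (independently (connect T a)) λ r → 0≤𝟙 (informs? nodes G transfer T t a r u v))
        by (yes av) = begin
          ½ * 1ℚ
            ≡⟨ ℚ.*-identityʳ ½ ⟩
          ½
            ≤⟨ ½≤1-ε ⟩
          1ℚ - ε
            ≤⟨ transfers (u≢v ∘ Nodes.id-injective nodes) (T u) (T v) t-smallest ⟩
          Pr (λ (Tᵤ′ , Tᵥ′) → (t ∈? Tᵤ′) ×-dec (t ∈? Tᵥ′)) (run (Nodes.id nodes u) (Nodes.id nodes v) (T u) (T v))
            ≡⟨ cong (Pr λ (Tᵤ′ , Tᵥ′) → (t ∈? Tᵤ′) ×-dec (t ∈? Tᵥ′)) (connect-just a av) ⟨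
          Pr (λ (Tᵤ′ , Tᵥ′) → (t ∈? Tᵤ′) ×-dec (t ∈? Tᵥ′)) (connect T a v)
            ≤⟨ 𝔼-mono (connect T a v) (Always-all (connect T a v) λ x → x)
                 (λ (Tᵤ′ , Tᵥ′) _ → 𝟙-mono ((t ∈? Tᵤ′) ×-dec (t ∈? Tᵥ′)) (t ∈? Tᵥ′) proj₂) ⟩
          𝔼 (λ (_ , Tᵥ′) → 𝟙 (t ∈? Tᵥ′)) (connect T a v)
            ≡⟨ 𝔼-independently (λ (_ , Tᵥ′) → 𝟙 (t ∈? Tᵥ′)) (connect T a) v ⟨
          𝔼 (λ r → 𝟙 (t ∈? proj₂ (r v))) (independently (connect T a))
            ≤⟨ 𝔼-mono (independently (connect T a)) (Always-all (independently (connect T a)) λ x → x)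
                 (λ r _ → 𝟙-mono (t ∈? proj₂ (r v)) (informs? nodes G transfer T t a r u v)
                   λ t∈ → u∈S , v∉S , av , t∈) ⟩
          𝔼 (λ r → 𝟙 (informs? nodes G transfer T t a r u v)) (independently (connect T a)) ∎

      -- All proposers to `v` are neighbors of `v`, so at most `d` proposals compete, that of `u`
      -- included.
      accepts : ∀ (p : Choices) → (∀ w {x} → p w ≡ just x → x ∈ nbrs G w) →
        c * (𝟙 (p v ≟ᴹ nothing) * 𝟙 (p u ≟ᴹ just v)) ≤
        𝔼 (λ a → 𝟙 (a v ≟ᴹ just u)) (independently (accept p))
      accepts p p-edge = ≤-≡-trans (by (p v ≟ᴹ nothing) (p u ≟ᴹ just v))
        (sym (𝔼-independently (λ x → 𝟙 (x ≟ᴹ just u)) (accept p) v))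
        where
        by : (pv? : Dec (p v ≡ nothing)) (pu? : Dec (p u ≡ just v)) →
             c * (𝟙 pv? * 𝟙 pu?) ≤ 𝔼 (λ x → 𝟙 (x ≟ᴹ just u)) (accept p v)
        by (no _) pu? = ≡-≤-trans (trans (cong (c *_) (ℚ.*-zeroˡ (𝟙 pu?))) (ℚ.*-zeroʳ c))
          (0≤𝔼 (accept p v) λ x → 0≤𝟙 (x ≟ᴹ just u))
        by (yes _) (no _) = ≡-≤-trans (ℚ.*-zeroʳ c) (0≤𝔼 (accept p v) λ x → 0≤𝟙 (x ≟ᴹ just u))
        by (yes pv) (yes pu) = ≡-≤-trans (ℚ.*-identityʳ c) (≤-≡-trans
          (Pr-uniform (proposersTo p v) (∈-filter⁺ (λ w → p w ≟ᴹ just v) (∈-allFin u) pu)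
            (ℕ.≤-trans (length-filter-tabulate (λ w → p w ≟ᴹ just v) id (nbrs G v)
                         (λ w pw → symmetric G (p-edge w pw)))
                       (degree≤d v))
            0≤c cd≤1)
          (cong (𝔼 λ x → 𝟙 (x ≟ᴹ just u)) (sym (accept-nothing p pv))))

      -- Each stage is bounded given the earlier ones. That `v` is silent and that `u` proposes to
      -- `v` are decided by different nodes, so their probabilities multiply.
      informs-likely : v ∈ nbrs G u →
        ½ * (c * (½ * (½ * c))) ≤ 𝔼³ nodes G transfer T (λ p a r → 𝟙 (informs? nodes G transfer T t a r u v))
      informs-likely v∈nbrs = begin
        ½ * (c * (½ * (½ * c)))
          ≤⟨ *-monoʳ 0≤½ (*-monoʳ 0≤c (*-mono 0≤½ (0≤𝔼 (blindPropose (nbrs G u)) λ x → 0≤𝟙 (x ≟ᴹ just v))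
               (Pr-blindPropose-nothing (nbrs G v))
               (Pr-blindPropose-just (nbrs G u) v∈nbrs (degree≤d u) 0≤c cd≤1))) ⟩
        ½ * (c * (𝔼 (λ x → 𝟙 (x ≟ᴹ nothing)) (blindPropose (nbrs G v)) *
                  𝔼 (λ x → 𝟙 (x ≟ᴹ just v)) (blindPropose (nbrs G u))))
          ≡⟨ cong (λ x → ½ * (c * x)) (𝔼-independently₂ (λ x → 𝟙 (x ≟ᴹ nothing)) (λ x → 𝟙 (x ≟ᴹ just v))
               (λ u → blindPropose (nbrs G u)) (u≢v ∘ sym)) ⟨
        ½ * (c * 𝔼 (λ p → 𝟙 (p v ≟ᴹ nothing) * 𝟙 (p u ≟ᴹ just v)) proposals)
          ≡⟨ cong (½ *_) (𝔼-* c (λ p → 𝟙 (p v ≟ᴹ nothing) * 𝟙 (p u ≟ᴹ just v)) proposals) ⟨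
        ½ * 𝔼 (λ p → c * (𝟙 (p v ≟ᴹ nothing) * 𝟙 (p u ≟ᴹ just v))) proposals
          ≤⟨ *-monoʳ 0≤½ (𝔼-mono proposals (Always-independently λ u → Always-blindPropose (nbrs G u)) accepts) ⟩
        ½ * 𝔼 (λ p → 𝔼 (λ a → 𝟙 (a v ≟ᴹ just u)) (independently (accept p))) proposals
          ≡⟨ 𝔼-* ½ (λ p → 𝔼 (λ a → 𝟙 (a v ≟ᴹ just u)) (independently (accept p))) proposals ⟨
        𝔼 (λ p → ½ * 𝔼 (λ a → 𝟙 (a v ≟ᴹ just u)) (independently (accept p))) proposals
          ≡⟨ 𝔼-cong proposals (λ p → 𝔼-* ½ (λ a → 𝟙 (a v ≟ᴹ just u)) (independently (accept p))) ⟨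
        𝔼 (λ p → 𝔼 (λ a → ½ * 𝟙 (a v ≟ᴹ just u)) (independently (accept p))) proposals
          ≤⟨ 𝔼-mono proposals (Always-all proposals λ x → x) (λ p _ →
               𝔼-mono (independently (accept p)) (Always-all (independently (accept p)) λ x → x) λ a _ →
               informs-by-transfer a) ⟩
        𝔼³ nodes G transfer T (λ p a r → 𝟙 (informs? nodes G transfer T t a r u v)) ∎
        where
        open ℚ.≤-Reasoning
        proposals : Rand Choices
        proposals = independently λ u → blindPropose (nbrs G u)

  -- Linearity of expectation over ordered pairs: the events at different edges are dependent, but
  -- only their separate probabilities enter.
  𝔼-informed : ½ * (c * (½ * (½ * c))) * cut G S ≤ 𝔼³ nodes G transfer T (informed nodes G transfer T t)
  𝔼-informed = begin
    q * cut G S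
      ≡⟨ *-distribˡ-sum q (λ v → sum λ u → 𝟙 (isCut? G S u v)) ⟩
    sum (λ v → q * sum (λ u → 𝟙 (isCut? G S u v)))
      ≡⟨ sum-cong-≗ (λ v → *-distribˡ-sum q (λ u → 𝟙 (isCut? G S u v))) ⟩
    sum (λ v → sum (λ u → q * 𝟙 (isCut? G S u v)))
      ≤⟨ sum-mono (λ v → sum-mono (λ u → by (isCut? G S u v))) ⟩
    sum (λ v → sum (λ u → 𝔼³ nodes G transfer T (λ p a r → 𝟙 (informs? nodes G transfer T t a r u v))))
      ≡⟨ sum-cong-≗ (λ v → 𝔼³-sum nodes G transfer T (λ u p a r → 𝟙 (informs? nodes G transfer T t a r u v))) ⟨
    sum (λ v → 𝔼³ nodes G transfer T (λ p a r → sum λ u → 𝟙 (informs? nodes G transfer T t a r u v)))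
      ≡⟨ 𝔼³-sum nodes G transfer T (λ v p a r → sum λ u → 𝟙 (informs? nodes G transfer T t a r u v)) ⟨
    𝔼³ nodes G transfer T (informed nodes G transfer T t) ∎
    where
    open ℚ.≤-Reasoning
    q : ℚ
    q = ½ * (c * (½ * (½ * c)))
    by : ∀ {u v} (cut? : Dec (IsCut G S u v)) →
         q * 𝟙 cut? ≤ 𝔼³ nodes G transfer T (λ p a r → 𝟙 (informs? nodes G transfer T t a r u v))
    by (yes (u∈S , v∉S , u∈nbrs)) = ≡-≤-trans (ℚ.*-identityʳ q) (informs-likely u∈S v∉S (symmetric G u∈nbrs))
    by {u} {v} (no _) = ≡-≤-trans (trans (ℚ.*-zeroʳ q) (sym (𝔼³-const nodes G transfer T 0ℚ)))
      (𝔼³-mono nodes G transfer T λ {_} {a} {r} _ → 0≤𝟙 (informs? nodes G transfer T t a r u v))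

-- The potential

-- 1/m, with recip 0 = 1.
recip : ℕ → ℚ
recip m = ℤ.+ 1 / suc (ℕ.pred m)

recip-* : ∀ {m} → 1 ℕ.≤ m → recip m * fromℕ m ≡ 1ℚ
recip-* {suc m} _ = /-* 1 (suc m)

0≤recip : ∀ m → 0ℚ ≤ recip m
0≤recip m = 0≤1/ (suc (ℕ.pred m))

recip≤1 : ∀ m → recip m ≤ 1ℚ
recip≤1 m = begin
  recip m                              ≡⟨ ℚ.*-identityʳ (recip m) ⟨
  recip m * fromℕ 1                    ≤⟨ *-monoʳ (0≤recip m) (fromℕ-mono {1} {suc (ℕ.pred m)} (s≤s z≤n)) ⟩
  recip m * fromℕ (suc (ℕ.pred m))     ≡⟨ /-* 1 (suc (ℕ.pred m)) ⟩
  1ℚ                                   ∎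
  where open ℚ.≤-Reasoning

-- 1/(s + x) ≤ 1/s − x/(2s²) for 0 ≤ x ≤ s, with r = 1/s and r′ = 1/s′.
reciprocal-drop : ∀ {r s r′ s′ x} → r * s ≡ 1ℚ → r′ * s′ ≡ 1ℚ → 0ℚ ≤ r → 0ℚ ≤ r′ → 0ℚ ≤ x →
                  x ≤ s → s + x ≤ s′ → r′ + ½ * (r * r) * x ≤ r
reciprocal-drop {r} {s} {r′} {s′} {x} rs≡1 r′s′≡1 0≤r 0≤r′ 0≤x x≤s s+x≤s′ =
  ≤-by-gap (0≤* 0≤r′ 0≤gap) r≡
  where
  open ≡-Reasoning
  -- `e` is the bound claimed for `r′`. Since r′s′ = 1, the claim r′ ≤ e amounts to s′e ≥ 1, and
  -- `gap` is the excess s′e - 1.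
  e gap : ℚ
  e = r - ½ * (r * r) * x
  gap = (s′ - (s + x)) * e + ½ * (r * r) * x * (s - x)
  0≤1-rx : 0ℚ ≤ 1ℚ - r * x
  0≤1-rx = gap≥0 (≤-≡-trans (*-monoʳ 0≤r x≤s) rs≡1)
  0≤e : 0ℚ ≤ e
  0≤e = ≤-≡-trans (0≤+ (0≤* 0≤½ 0≤r) (0≤* (0≤* 0≤½ 0≤r) 0≤1-rx))
    (solve 2 (λ r x → con ½ :* r :+ con ½ :* r :* (con 1ℚ :- r :* x) := r :- con ½ :* (r :* r) :* x) refl r x)
  0≤gap : 0ℚ ≤ gap
  0≤gap = 0≤+ (0≤* (gap≥0 s+x≤s′) 0≤e) (0≤* (0≤* (0≤* 0≤½ (0≤* 0≤r 0≤r)) 0≤x) (gap≥0 x≤s))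
  s′e≡ : s′ * e ≡ 1ℚ + gap
  s′e≡ = begin
    s′ * e
      ≡⟨ solve 4 (λ r s s′ x → s′ :* (r :- con ½ :* (r :* r) :* x) :=
           con 1ℚ :+ ((s′ :- (s :+ x)) :* (r :- con ½ :* (r :* r) :* x) :+ con ½ :* (r :* r) :* x :* (s :- x))
                  :+ (r :* s :- con 1ℚ) :* (con 1ℚ :- r :* x)) refl r s s′ x ⟩
    1ℚ + gap + (r * s - 1ℚ) * (1ℚ - r * x)
      ≡⟨ cong (λ y → 1ℚ + gap + (y - 1ℚ) * (1ℚ - r * x)) rs≡1 ⟩
    1ℚ + gap + (1ℚ - 1ℚ) * (1ℚ - r * x)
      ≡⟨ solve 2 (λ g y → con 1ℚ :+ g :+ (con 1ℚ :- con 1ℚ) :* y := con 1ℚ :+ g) refl gap (1ℚ - r * x) ⟩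
    1ℚ + gap ∎
  r≡ : r ≡ r′ + ½ * (r * r) * x + r′ * gap
  r≡ = begin
    r
      ≡⟨ solve 2 (λ r k → r := con 1ℚ :* (r :- k) :+ k) refl r (½ * (r * r) * x) ⟩
    1ℚ * e + ½ * (r * r) * x
      ≡⟨ cong (λ y → y * e + ½ * (r * r) * x) r′s′≡1 ⟨
    r′ * s′ * e + ½ * (r * r) * x
      ≡⟨ cong (_+ ½ * (r * r) * x) (trans (ℚ.*-assoc r′ s′ e) (cong (r′ *_) s′e≡)) ⟩
    r′ * (1ℚ + gap) + ½ * (r * r) * x
      ≡⟨ solve 3 (λ r′ g k → r′ :* (con 1ℚ :+ g) :+ k := r′ :+ k :+ r′ :* g) refl r′ gap (½ * (r * r) * x) ⟩
    r′ + ½ * (r * r) * x + r′ * gap ∎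

Φ : ℕ → ℕ → ℚ
Φ n s = fromℕ n * recip s - 1ℚ

Φ-split : ∀ {s u} → 1 ℕ.≤ s → s ℕ.+ u ≡ n → Φ n s ≡ fromℕ u * recip s
Φ-split {s = s} {u} 1≤s refl = begin
  fromℕ (s ℕ.+ u) * recip s - 1ℚ                    ≡⟨ cong (λ x → x * recip s - 1ℚ) (fromℕ-+ s u) ⟩
  (fromℕ s + fromℕ u) * recip s - 1ℚ                ≡⟨ solve 3 (λ s u r → (s :+ u) :* r :- con 1ℚ := u :* r :+ (r :* s :- con 1ℚ)) refl (fromℕ s) (fromℕ u) (recip s) ⟩
  fromℕ u * recip s + (recip s * fromℕ s - 1ℚ)      ≡⟨ cong (λ x → fromℕ u * recip s + (x - 1ℚ)) (recip-* 1≤s) ⟩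
  fromℕ u * recip s + 0ℚ                            ≡⟨ ℚ.+-identityʳ _ ⟩
  fromℕ u * recip s                                 ∎
  where open ≡-Reasoning

1≤nΦ : ∀ {s u} → 1 ℕ.≤ s → 1 ℕ.≤ u → s ℕ.+ u ≡ n → 1ℚ ≤ fromℕ n * Φ n s
1≤nΦ {n} {s} {u} 1≤s 1≤u eq = begin
  1ℚ                                ≤⟨ fromℕ-mono 1≤u ⟩
  fromℕ u                           ≡⟨ ℚ.*-identityʳ (fromℕ u) ⟨
  fromℕ u * 1ℚ                      ≡⟨ cong (fromℕ u *_) (recip-* 1≤s) ⟨
  fromℕ u * (recip s * fromℕ s)     ≤⟨ *-monoʳ (0≤fromℕ u) (*-monoʳ (0≤recip s) (fromℕ-mono (ℕ.m+n≤o⇒m≤o s (ℕ.≤-reflexive eq)))) ⟩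
  fromℕ u * (recip s * fromℕ n)     ≡⟨ solve 3 (λ u r n → u :* (r :* n) := n :* (u :* r)) refl (fromℕ u) (recip s) (fromℕ n) ⟩
  fromℕ n * (fromℕ u * recip s)     ≡⟨ cong (fromℕ n *_) (Φ-split 1≤s eq) ⟨
  fromℕ n * Φ n s                   ∎
  where open ℚ.≤-Reasoning

Φ-drop : ∀ {s s′ x} → 1 ℕ.≤ s → 1 ℕ.≤ s′ → 0ℚ ≤ x → x ≤ fromℕ s → fromℕ s + x ≤ fromℕ s′ →
         Φ n s′ + fromℕ n * (½ * (recip s * recip s)) * x ≤ Φ n s
Φ-drop {n} {s} {s′} {x} 1≤s 1≤s′ 0≤x x≤s s+x≤s′ = begin
  fromℕ n * recip s′ - 1ℚ + fromℕ n * k * x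
    ≡⟨ solve 4 (λ n r k x → n :* r :- con 1ℚ :+ n :* k :* x := n :* (r :+ k :* x) :- con 1ℚ) refl (fromℕ n) (recip s′) k x ⟩
  fromℕ n * (recip s′ + k * x) - 1ℚ
    ≤⟨ ℚ.+-monoˡ-≤ (- 1ℚ) (*-monoʳ (0≤fromℕ n) (reciprocal-drop (recip-* 1≤s) (recip-* 1≤s′) (0≤recip s) (0≤recip s′) 0≤x x≤s s+x≤s′)) ⟩
  fromℕ n * recip s - 1ℚ ∎
  where
  open ℚ.≤-Reasoning
  k : ℚ
  k = ½ * (recip s * recip s)

0<∣p∣ : ∀ {x} {S : Subset n} → x ∈ S → 1 ℕ.≤ ∣ S ∣
0<∣p∣ {x = x} {S} x∈S = ℕ.≤-trans (ℕ.≤-reflexive (sym (∣⁅x⁆∣≡1 x)))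
  (p⊆q⇒∣p∣≤∣q∣ λ y∈ → subst (_∈ S) (sym (x∈⁅y⁆⇒x≡y x y∈)) x∈S)

Held Complete : Knowledge n N → Fin N → Set
Held T t = ∃[ u ] t ∈ T u
Complete T t = ∀ u → t ∈ T u

complete? : (T : Knowledge n N) → Decidable (Complete T)
complete? T t = Fin.all? λ u → t ∈? T u

φ : Fin N → Knowledge n N → ℚ
φ {n = n} t T = Φ n ∣ knowers t T ∣

weight : ℕ → ℕ → ℚ
weight n m = (fromℕ n * fromℕ n) ^^ m

-- The list is meant to be increasing. A weight counts the tokens that come later, so removing a
-- complete head leaves the weights of the rest unchanged.
Ψ : List (Fin N) → Knowledge n N → ℚ
Ψ         []       T = 0ℚ
Ψ {n = n} (t ∷ ts) T = weight n (length ts) * φ t T + Ψ ts T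

module _ {T : Knowledge n N} {t : Fin N} where

  0<knowers : Held T t → 1 ℕ.≤ ∣ knowers t T ∣
  0<knowers (u , t∈) = 0<∣p∣ (∈-knowers⁺ t T {u} t∈)

  knowers-complete : Complete T t → ∣ knowers t T ∣ ≡ n
  knowers-complete com = ℕ.≤-antisym (∣p∣≤n (knowers t T)) (ℕ.≤-trans (ℕ.≤-reflexive (sym (∣⊤∣≡n n)))
    (p⊆q⇒∣p∣≤∣q∣ {p = ⊤} λ {u} _ → ∈-knowers⁺ t T (com u)))

  0<∁knowers : ¬ Complete T t → 1 ℕ.≤ ∣ ∁ (knowers t T) ∣
  0<∁knowers ¬com = let u , t∉ = Fin.¬∀⟶∃¬ n _ (λ u → t ∈? T u) ¬com in
    0<∣p∣ {x = u} (x∉p⇒x∈∁p (t∉ ∘ ∈-knowers⁻ t T))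

  φ-complete : 1 ℕ.≤ n → Complete T t → φ t T ≡ 0ℚ
  φ-complete 1≤n com = begin
    fromℕ n * recip ∣ knowers t T ∣ - 1ℚ  ≡⟨ cong (λ m → fromℕ n * recip m - 1ℚ) (knowers-complete com) ⟩
    fromℕ n * recip n - 1ℚ                ≡⟨ cong (_- 1ℚ) (trans (ℚ.*-comm (fromℕ n) (recip n)) (recip-* 1≤n)) ⟩
    0ℚ                                    ∎
    where open ≡-Reasoning

  φ-split : Held T t → φ t T ≡ fromℕ ∣ ∁ (knowers t T) ∣ * recip ∣ knowers t T ∣
  φ-split held = Φ-split (0<knowers held) (∣p∣+∣∁p∣≡n (knowers t T))

  0≤φ : Held T t → 0ℚ ≤ φ t T
  0≤φ held = ≤-≡-trans (0≤* (0≤fromℕ ∣ ∁ (knowers t T) ∣) (0≤recip ∣ knowers t T ∣)) (sym (φ-split held))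

  1≤nφ : Held T t → ¬ Complete T t → 1ℚ ≤ fromℕ n * φ t T
  1≤nφ held ¬com = 1≤nΦ (0<knowers held) (0<∁knowers ¬com) (∣p∣+∣∁p∣≡n (knowers t T))

  -- Follows from `recip≤1`. The extra 1 is the room for all later tokens in `nΨ≤weight`.
  nφ+1≤n² : 1 ℕ.≤ n → fromℕ n * φ t T + 1ℚ ≤ fromℕ n * fromℕ n
  nφ+1≤n² 1≤n = ≤-by-gap
    (0≤+ (0≤* (0≤* (0≤fromℕ n) (0≤fromℕ n)) (gap≥0 (recip≤1 s))) (gap≥0 (fromℕ-mono 1≤n)))
    (solve 2 (λ n r → n :* n := n :* (n :* r :- con 1ℚ) :+ con 1ℚ :+ (n :* n :* (con 1ℚ :- r) :+ (n :- con 1ℚ)))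
      refl (fromℕ n) (recip s))
    where s = ∣ knowers t T ∣

1≤n*n : 1 ℕ.≤ n → 1ℚ ≤ fromℕ n * fromℕ n
1≤n*n {n} 1≤n = *-mono {p = 1ℚ} 0≤1 (0≤fromℕ n) (fromℕ-mono 1≤n) (fromℕ-mono 1≤n)

1≤^^ : 1ℚ ≤ p → ∀ m → 1ℚ ≤ p ^^ m
1≤^^ 1≤p zero    = ℚ.≤-refl
1≤^^ 1≤p (suc m) = *-mono {p = 1ℚ} 0≤1 (ℚ.≤-trans 0≤1 (1≤^^ 1≤p m)) 1≤p (1≤^^ 1≤p m)

module _ (1≤n : 1 ℕ.≤ n) where

  1≤weight : ∀ m → 1ℚ ≤ weight n m
  1≤weight = 1≤^^ (1≤n*n 1≤n)

  0≤weight : ∀ m → 0ℚ ≤ weight n m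
  0≤weight m = ℚ.≤-trans 0≤1 (1≤weight m)

  0≤Ψ : ∀ {T : Knowledge n N} l → All (Held T) l → 0ℚ ≤ Ψ l T
  0≤Ψ []       []       = ℚ.≤-refl
  0≤Ψ (t ∷ ts) (h ∷ hs) = 0≤+ (0≤* (0≤weight (length ts)) (0≤φ h)) (0≤Ψ ts hs)

  -- A geometric series in disguise: the head takes at most n² - 1 times its weight `w`, the tail
  -- one more `w`.
  nΨ≤weight : ∀ {T : Knowledge n N} l → fromℕ n * Ψ l T ≤ weight n (length l)
  nΨ≤weight []       = ≡-≤-trans (ℚ.*-zeroʳ (fromℕ n)) 0≤1
  nΨ≤weight {T = T} (t ∷ ts) = begin
    fromℕ n * (w * φ t T + Ψ ts T)
      ≡⟨ solve 4 (λ n w x y → n :* (w :* x :+ y) := w :* (n :* x) :+ n :* y) refl (fromℕ n) w (φ t T) (Ψ ts T) ⟩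
    w * (fromℕ n * φ t T) + fromℕ n * Ψ ts T
      ≤⟨ ℚ.+-monoʳ-≤ (w * (fromℕ n * φ t T)) (nΨ≤weight ts) ⟩
    w * (fromℕ n * φ t T) + w
      ≡⟨ solve 2 (λ w x → w :* x :+ w := w :* (x :+ con 1ℚ)) refl w (fromℕ n * φ t T) ⟩
    w * (fromℕ n * φ t T + 1ℚ)
      ≤⟨ *-monoʳ (0≤weight (length ts)) (nφ+1≤n² {T = T} {t} 1≤n) ⟩
    w * (fromℕ n * fromℕ n)
      ≡⟨ ℚ.*-comm w (fromℕ n * fromℕ n) ⟩
    fromℕ n * fromℕ n * w ∎
    where
    open ℚ.≤-Reasoning
    w : ℚ
    w = weight n (length ts)

  -- The tail is at most w/n, and an incomplete head contributes at least w/n.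
  tail≤head : ∀ {T : Knowledge n N} {t} ts → Held T t → ¬ Complete T t →
              Ψ ts T ≤ weight n (length ts) * φ t T
  tail≤head {T = T} {t} ts h ¬com = begin
    Ψ ts T                                      ≡⟨ cancel (Ψ ts T) ⟩
    recip n * (fromℕ n * Ψ ts T)                ≤⟨ *-monoʳ (0≤recip n) (nΨ≤weight ts) ⟩
    recip n * w                                 ≡⟨ cong (recip n *_) (ℚ.*-identityʳ w) ⟨
    recip n * (w * 1ℚ)                          ≤⟨ *-monoʳ (0≤recip n) (*-monoʳ (0≤weight (length ts)) (1≤nφ h ¬com)) ⟩
    recip n * (w * (fromℕ n * φ t T))           ≡⟨ cong (recip n *_) (solve 3 (λ w n x → w :* (n :* x) := n :* (w :* x)) refl w (fromℕ n) (φ t T)) ⟩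
    recip n * (fromℕ n * (w * φ t T))           ≡⟨ cancel (w * φ t T) ⟨
    w * φ t T                                   ∎
    where
    open ℚ.≤-Reasoning
    w : ℚ
    w = weight n (length ts)
    cancel : ∀ x → x ≡ recip n * (fromℕ n * x)
    cancel x = trans (sym (ℚ.*-identityˡ x)) (trans (cong (_* x) (sym (recip-* 1≤n))) (ℚ.*-assoc (recip n) (fromℕ n) x))

  -- The threshold for Markov's inequality: whichever token is incomplete, its weight is at least 1
  -- and its `φ` at least 1/n.
  incomplete⇒1≤nΨ : ∀ {T : Knowledge n N} l → All (Held T) l → ¬ All (Complete T) l → 1ℚ ≤ fromℕ n * Ψ l T
  incomplete⇒1≤nΨ [] [] ¬all = contradiction [] ¬all
  incomplete⇒1≤nΨ {T = T} (t ∷ ts) (h ∷ hs) ¬all = by (complete? T t)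
    where
    open ℚ.≤-Reasoning
    w : ℚ
    w = weight n (length ts)
    by : Dec (Complete T t) → 1ℚ ≤ fromℕ n * (w * φ t T + Ψ ts T)
    by (yes com) = begin
      1ℚ                               ≤⟨ incomplete⇒1≤nΨ ts hs (λ all → ¬all (com ∷ all)) ⟩
      fromℕ n * Ψ ts T                 ≤⟨ *-monoʳ (0≤fromℕ n) (≤-by-gap (0≤* (0≤weight (length ts)) (0≤φ h)) (ℚ.+-comm (w * φ t T) (Ψ ts T))) ⟩
      fromℕ n * (w * φ t T + Ψ ts T)   ∎
    by (no ¬com) = begin
      1ℚ                               ≤⟨ 1≤nφ h ¬com ⟩
      fromℕ n * φ t T                  ≡⟨ ℚ.*-identityˡ _ ⟨
      1ℚ * (fromℕ n * φ t T)           ≤⟨ *-monoˡ (0≤* (0≤fromℕ n) (0≤φ h)) (1≤weight (length ts)) ⟩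
      w * (fromℕ n * φ t T)            ≡⟨ solve 3 (λ w n x → w :* (n :* x) := n :* (w :* x)) refl w (fromℕ n) (φ t T) ⟩
      fromℕ n * (w * φ t T)            ≤⟨ *-monoʳ (0≤fromℕ n) (≤-by-gap (0≤Ψ ts hs) refl) ⟩
      fromℕ n * (w * φ t T + Ψ ts T)   ∎

-- With c = 1/Δ, the factors are the probabilities that the transfer succeeds, that the
-- acceptor picks this proposal, that it is a receiver, and that the proposer picks it.
informRate : ℚ → ℚ
informRate c = ½ * (c * (½ * (½ * c)))

contraction : ℚ → ℚ → ℚ
contraction c α = ½ * (½ * informRate c * α)

-- Expected decrease of the potential in one round

module _ (1≤n : 1 ℕ.≤ n) {T T′ : Knowledge n N} (grows : ∀ u → T u ⊆ T′ u) where

  held-grows : ∀ {t} → Held T t → Held T′ t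
  held-grows (u , t∈) = u , grows u t∈

  φ-complete-grows : ∀ {t} → Complete T t → φ t T′ ≡ 0ℚ
  φ-complete-grows {t} com = φ-complete {T = T′} {t} 1≤n (λ u → grows u (com u))

  φ-drop : ∀ {t x} → Held T t → 0ℚ ≤ x → x ≤ fromℕ ∣ knowers t T ∣ →
           fromℕ ∣ knowers t T ∣ + x ≤ fromℕ ∣ knowers t T′ ∣ →
           φ t T′ + fromℕ n * (½ * (recip ∣ knowers t T ∣ * recip ∣ knowers t T ∣)) * x ≤ φ t T
  φ-drop {t} held = Φ-drop {n} (0<knowers held) (0<knowers (held-grows held))

  -- The case `x = 0` of `φ-drop`.
  φ-antitone : ∀ {t} → Held T t → φ t T′ ≤ φ t T
  φ-antitone {t} held = ≡-≤-trans
    (sym (trans (cong (φ t T′ +_) (ℚ.*-zeroʳ (fromℕ n * (½ * (r * r))))) (ℚ.+-identityʳ (φ t T′))))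
    (φ-drop held ℚ.≤-refl (0≤fromℕ ∣ knowers t T ∣) (≡-≤-trans (ℚ.+-identityʳ _) (fromℕ-mono
      (p⊆q⇒∣p∣≤∣q∣ {p = knowers t T} λ {u} u∈ → ∈-knowers⁺ t T′ {u} (grows u (∈-knowers⁻ t T u∈))))))
    where
    r : ℚ
    r = recip ∣ knowers t T ∣

  Ψ-antitone : ∀ l → All (Held T) l → Ψ l T′ ≤ Ψ l T
  Ψ-antitone []       []       = ℚ.≤-refl
  Ψ-antitone (t ∷ ts) (h ∷ hs) =
    ℚ.+-mono-≤ (*-monoʳ (0≤weight 1≤n (length ts)) (φ-antitone h)) (Ψ-antitone ts hs)

module _ (1≤n : 1 ℕ.≤ n) (nodes : Nodes n N) (G : Graph n) (transfer : Transfer N ε) (T : Knowledge n N)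
         (½≤1-ε : ½ ≤ 1ℚ - ε)
         {d : ℕ} (degree≤d : ∀ u → degree G u ℕ.≤ d) {c : ℚ} (0≤c : 0ℚ ≤ c) (cd≤1 : c * fromℕ d ≤ 1ℚ)
         {α : ℚ} (0≤α : 0ℚ ≤ α) (α-least : ∀ {q} → (∃[ S ] Ratio G S q) → α ≤ q)  where

  open Round nodes G blindPropose (Transfer.run transfer)

  private
    q : ℚ
    q = informRate c

    0≤q : 0ℚ ≤ q
    0≤q = 0≤* 0≤½ (0≤* 0≤c (0≤* 0≤½ (0≤* 0≤½ 0≤c)))

    always-grows : Always (λ T′ → ∀ u → T u ⊆ T′ u) (round T)
    always-grows = Always-round nodes G transfer T λ valid u {_} → proj₁ (update-grows nodes G transfer T valid u)

  -- The slope n/(2s²) times the expected gain, at least q α s(n - s)/n, leaves ½ q α (n - s)/s, and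
  -- the last quotient is `φ`.
  𝔼-φ-drop : ∀ {t} → Held T t → (∀ {x u} → x ∈ T u → x Fin.< t → ∀ v → x ∈ T v) →
    ½ * q * α * φ t T ≤
    fromℕ n * (½ * (recip ∣ knowers t T ∣ * recip ∣ knowers t T ∣)) * 𝔼³ nodes G transfer T (informed nodes G transfer T t)
  𝔼-φ-drop {t} held smaller-known = begin
    ½ * q * α * φ t T
      ≡⟨ cong (½ * q * α *_) (φ-split held) ⟩
    ½ * q * α * (u * r)
      ≡⟨ solve 4 (λ q α u r → con ½ :* q :* α :* (u :* r) := con 1ℚ :* (con ½ :* q :* α :* (u :* r))) refl q α u r ⟩
    1ℚ * (½ * q * α * (u * r))
      ≡⟨ cong (_* (½ * q * α * (u * r))) (recip-* (0<knowers held)) ⟨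
    r * s * (½ * q * α * (u * r))
      ≡⟨ solve 5 (λ q α u r s → r :* s :* (con ½ :* q :* α :* (u :* r)) :=
           con ½ :* (r :* r) :* q :* (α :* (s :* u))) refl q α u r s ⟩
    ½ * (r * r) * q * (α * (s * u))
      ≤⟨ *-monoʳ (0≤* (0≤* 0≤½ (0≤* (0≤recip ∣ S ∣) (0≤recip ∣ S ∣))) 0≤q) (expansion-cut G 0≤α α-least S) ⟩
    ½ * (r * r) * q * (fromℕ n * cut G S)
      ≡⟨ solve 4 (λ r q n x → con ½ :* (r :* r) :* q :* (n :* x) := n :* (con ½ :* (r :* r)) :* (q :* x)) refl r q (fromℕ n) (cut G S) ⟩
    fromℕ n * (½ * (r * r)) * (q * cut G S)
      ≤⟨ *-monoʳ (0≤* (0≤fromℕ n) (0≤* 0≤½ (0≤* (0≤recip ∣ S ∣) (0≤recip ∣ S ∣))))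
           (𝔼-informed nodes G transfer T t ½≤1-ε smaller-known degree≤d 0≤c cd≤1) ⟩
    fromℕ n * (½ * (r * r)) * 𝔼³ nodes G transfer T (informed nodes G transfer T t) ∎
    where
    open ℚ.≤-Reasoning
    S : Subset n
    S = knowers t T
    s u r : ℚ
    s = fromℕ ∣ S ∣
    u = fromℕ ∣ ∁ S ∣
    r = recip ∣ S ∣

  -- Only the head is known to shrink; the tail merely does not grow. As the tail is at most the
  -- head, the drop of the head is still a fixed share of the whole, at the cost of the outer ½ in
  -- `contraction`.
  𝔼-Ψ-drop : ∀ t ts → All (Held T) (t ∷ ts) → ¬ Complete T t →
    (∀ {x u} → x ∈ T u → x Fin.< t → ∀ v → x ∈ T v) →
    𝔼 (Ψ (t ∷ ts)) (round T) ≤ (1ℚ - contraction c α) * Ψ (t ∷ ts) T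
  𝔼-Ψ-drop t ts (h ∷ hs) ¬com smaller-known = ≤-by-gap (gap≥0 total) 
    (solve 3 (λ e d p → (con 1ℚ :- d) :* p := e :+ (p :- (e :+ d :* p))) refl E (contraction c α) (Ψ (t ∷ ts) T))
    where
    open ℚ.≤-Reasoning
    w κ E X̄ : ℚ
    w = weight n (length ts)
    κ = fromℕ n * (½ * (recip ∣ knowers t T ∣ * recip ∣ knowers t T ∣))
    E = 𝔼 (Ψ (t ∷ ts)) (round T)
    X̄ = 𝔼³ nodes G transfer T (informed nodes G transfer T t)
    0≤w : 0ℚ ≤ w
    0≤w = 0≤weight 1≤n (length ts)
    δΨ≤ : contraction c α * Ψ (t ∷ ts) T ≤ w * κ * X̄
    δΨ≤ = begin
      contraction c α * (w * φ t T + Ψ ts T)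
        ≤⟨ *-monoʳ (0≤* 0≤½ (0≤* (0≤* 0≤½ 0≤q) 0≤α)) (ℚ.+-monoʳ-≤ (w * φ t T) (tail≤head 1≤n ts h ¬com)) ⟩
      contraction c α * (w * φ t T + w * φ t T)
        ≡⟨ solve 3 (λ a w f → con ½ :* a :* (w :* f :+ w :* f) := w :* (a :* f)) refl (½ * q * α) w (φ t T) ⟩
      w * (½ * q * α * φ t T)
        ≤⟨ *-monoʳ 0≤w (𝔼-φ-drop h smaller-known) ⟩
      w * (κ * X̄)
        ≡⟨ ℚ.*-assoc w κ X̄ ⟨
      w * κ * X̄ ∎
    -- Linear in `informed` for every outcome, so averaging both sides needs no convexity argument.
    pathwise : ∀ {p a r} → ValidRound nodes G transfer T p a r →
      Ψ (t ∷ ts) (update T p a r) + w * κ * informed nodes G transfer T t p a r ≤ Ψ (t ∷ ts) T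
    pathwise {p} {a} {r} valid = begin
      w * φ t T′ + Ψ ts T′ + w * κ * x
        ≡⟨ solve 5 (λ w f y k x → w :* f :+ y :+ w :* k :* x := w :* (f :+ k :* x) :+ y) refl w (φ t T′) (Ψ ts T′) κ x ⟩
      w * (φ t T′ + κ * x) + Ψ ts T′
        ≤⟨ ℚ.+-mono-≤
             (*-monoʳ 0≤w (φ-drop 1≤n grows h (0≤informed nodes G transfer T t p a r)
               (informed≤knowers nodes G transfer T t valid) (knowers+informed≤ nodes G transfer T t valid)))
             (Ψ-antitone 1≤n grows ts hs) ⟩
      w * φ t T + Ψ ts T ∎
      where
      T′ : Knowledge n N
      T′ = update T p a r
      x : ℚ
      x = informed nodes G transfer T t p a r
      grows : ∀ u → T u ⊆ T′ u
      grows u {_} = proj₁ (update-grows nodes G transfer T valid u)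
    total : E + contraction c α * Ψ (t ∷ ts) T ≤ Ψ (t ∷ ts) T
    total = begin
      E + contraction c α * Ψ (t ∷ ts) T
        ≤⟨ ℚ.+-monoʳ-≤ E δΨ≤ ⟩
      E + w * κ * X̄
        ≡⟨ cong₂ _+_ (𝔼-round nodes G transfer T (Ψ (t ∷ ts)))
             (sym (𝔼³-* nodes G transfer T (w * κ) (informed nodes G transfer T t))) ⟩
      𝔼³ nodes G transfer T (λ p a r → Ψ (t ∷ ts) (update T p a r)) +
      𝔼³ nodes G transfer T (λ p a r → w * κ * informed nodes G transfer T t p a r)
        ≡⟨ 𝔼³-+ nodes G transfer T _ _ ⟨
      𝔼³ nodes G transfer T (λ p a r → Ψ (t ∷ ts) (update T p a r) + w * κ * informed nodes G transfer T t p a r)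
        ≤⟨ 𝔼³-mono nodes G transfer T pathwise ⟩
      𝔼³ nodes G transfer T (λ _ _ _ → Ψ (t ∷ ts) T)
        ≡⟨ 𝔼³-const nodes G transfer T (Ψ (t ∷ ts) T) ⟩
      Ψ (t ∷ ts) T ∎

  -- Complete tokens at the front contribute 0 before and after the round and are removed until the
  -- head is incomplete. The last hypothesis records that whatever has left the list is complete, so
  -- every token below the head is known everywhere or nowhere.
  𝔼-Ψ-round : ∀ l → AllPairs Fin._<_ l → All (Held T) l →
    (∀ {x u} → x ∈ T u → Complete T x ⊎ x ∈ˡ l) →
    𝔼 (Ψ l) (round T) ≤ (1ℚ - contraction c α) * Ψ l T
  𝔼-Ψ-round [] [] [] _ = ≤-≡-trans (ℚ.≤-reflexive (𝔼-const 0ℚ (round T))) (sym (ℚ.*-zeroʳ (1ℚ - contraction c α)))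
  𝔼-Ψ-round (t ∷ ts) (t< ∷ sorted) (h ∷ hs) covered = by (complete? T t)
    where
    open ℚ.≤-Reasoning
    w : ℚ
    w = weight n (length ts)
    skip : ∀ {f} → f ≡ 0ℚ → ∀ y → w * f + y ≡ y
    skip refl y = trans (cong (_+ y) (ℚ.*-zeroʳ w)) (ℚ.+-identityˡ y)
    by : Dec (Complete T t) → 𝔼 (Ψ (t ∷ ts)) (round T) ≤ (1ℚ - contraction c α) * Ψ (t ∷ ts) T
    by (yes com) = begin
      𝔼 (Ψ (t ∷ ts)) (round T)
        ≤⟨ 𝔼-mono (round T) always-grows (λ T′ grows →
             ℚ.≤-reflexive (skip (φ-complete-grows 1≤n grows com) (Ψ ts T′))) ⟩
      𝔼 (Ψ ts) (round T)
        ≤⟨ 𝔼-Ψ-round ts sorted hs rest-covered ⟩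
      (1ℚ - contraction c α) * Ψ ts T
        ≡⟨ cong ((1ℚ - contraction c α) *_) (skip (φ-complete 1≤n com) (Ψ ts T)) ⟨
      (1ℚ - contraction c α) * Ψ (t ∷ ts) T ∎
      where
      rest-covered : ∀ {x u} → x ∈ T u → Complete T x ⊎ x ∈ˡ ts
      rest-covered x∈ with covered x∈
      ... | inj₁ com′        = inj₁ com′
      ... | inj₂ (here refl) = inj₁ com
      ... | inj₂ (there x∈ts) = inj₂ x∈ts
    by (no ¬com) = 𝔼-Ψ-drop t ts (h ∷ hs) ¬com λ x∈ x<t →
      Sum.[ id , (λ x∈l → contradiction x<t (≥t x∈l)) ]′ (covered x∈)
      where
      ≥t : ∀ {x} → x ∈ˡ (t ∷ ts) → ¬ x Fin.< t
      ≥t (here refl)  x<t = ℕ.<-irrefl refl x<t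
      ≥t (there x∈ts) x<t = ℕ.<-asym x<t (All.lookup t< x∈ts)

-- Iterating the rounds

fromℕ-^ : ∀ a m → fromℕ (a ℕ.^ m) ≡ fromℕ a ^^ m
fromℕ-^ a zero    = refl
fromℕ-^ a (suc m) = trans (fromℕ-* a (a ℕ.^ m)) (cong (fromℕ a *_) (fromℕ-^ a m))

0≤^^ : 0ℚ ≤ p → ∀ m → 0ℚ ≤ p ^^ m
0≤^^ 0≤p zero    = 0≤1
0≤^^ 0≤p (suc m) = 0≤* 0≤p (0≤^^ 0≤p m)

^^-monoʳ : 1ℚ ≤ p → ∀ {a b} → a ℕ.≤ b → p ^^ a ≤ p ^^ b
^^-monoʳ {p} 1≤p {b = b} z≤n = 1≤^^ 1≤p b
^^-monoʳ {p} 1≤p (s≤s a≤b)   = *-monoʳ (ℚ.≤-trans 0≤1 1≤p) (^^-monoʳ 1≤p a≤b)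

-- A division-free form of (1 - δ)^m ≤ 1/(1 + mδ), in place of an exponential bound. The induction
-- rests on (1 - δ)(1 + (1 + m)δ) = 1 + mδ - (1 + m)δ².
bernoulli : ∀ {δ} → 0ℚ ≤ δ → δ ≤ 1ℚ → ∀ m → (1ℚ - δ) ^^ m * (1ℚ + fromℕ m * δ) ≤ 1ℚ
bernoulli {δ} 0≤δ δ≤1 zero    = ℚ.≤-reflexive (solve 1 (λ d → con 1ℚ :* (con 1ℚ :+ con 0ℚ :* d) := con 1ℚ) refl δ)
bernoulli {δ} 0≤δ δ≤1 (suc m) = begin
  (1ℚ - δ) * decay * (1ℚ + fromℕ (suc m) * δ)
    ≡⟨ cong (λ x → (1ℚ - δ) * decay * (1ℚ + x * δ)) (fromℕ-suc m) ⟩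
  (1ℚ - δ) * decay * (1ℚ + (1ℚ + fromℕ m) * δ)
    ≤⟨ ≤-by-gap (0≤* (0≤^^ (gap≥0 δ≤1) m) (0≤* (0≤+ 0≤1 (0≤fromℕ m)) (0≤* 0≤δ 0≤δ)))
         (solve 3 (λ d p m → p :* (con 1ℚ :+ m :* d) :=
           (con 1ℚ :- d) :* p :* (con 1ℚ :+ (con 1ℚ :+ m) :* d) :+ p :* ((con 1ℚ :+ m) :* (d :* d))) refl δ decay (fromℕ m)) ⟩
  decay * (1ℚ + fromℕ m * δ)
    ≤⟨ bernoulli 0≤δ δ≤1 m ⟩
  1ℚ ∎
  where
  open ℚ.≤-Reasoning
  decay : ℚ
  decay = (1ℚ - δ) ^^ m

halving : ∀ {m} → 0ℚ ≤ p → p ^^ m * fromℕ 2 ≤ 1ℚ → ∀ K → p ^^ (K ℕ.* m) * fromℕ (2 ℕ.^ K) ≤ 1ℚ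
halving         0≤p half zero    = ℚ.≤-refl
halving {p} {m} 0≤p half (suc K) = begin
  p ^^ (m ℕ.+ K ℕ.* m) * fromℕ (2 ℕ.* 2 ℕ.^ K)
    ≡⟨ cong₂ _*_ (^-homo-* p m (K ℕ.* m)) (fromℕ-* 2 (2 ℕ.^ K)) ⟩
  p ^^ m * p ^^ (K ℕ.* m) * (fromℕ 2 * fromℕ (2 ℕ.^ K))
    ≡⟨ solve 4 (λ a b c d → a :* b :* (c :* d) := a :* c :* (b :* d)) refl (p ^^ m) (p ^^ (K ℕ.* m)) (fromℕ 2) (fromℕ (2 ℕ.^ K)) ⟩
  p ^^ m * fromℕ 2 * (p ^^ (K ℕ.* m) * fromℕ (2 ℕ.^ K))
    ≤⟨ *-mono {s = 1ℚ} {q = 1ℚ} (0≤* (0≤^^ 0≤p m) (0≤fromℕ 2)) 0≤1 half (halving {m = m} 0≤p half K) ⟩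
  1ℚ ∎
  where open ℚ.≤-Reasoning

-- The denominator serves as `M`, since the numerator is at least 1.
archimedean : ∀ δ → .{{Positive δ}} → ∃[ M ] 1ℚ ≤ fromℕ M * δ
archimedean δ@(ℚ.mkℚ ℤ.+[1+ a ] b _) = suc b , (begin
  1ℚ                                          ≤⟨ fromℕ-mono {1} {suc a} (s≤s z≤n) ⟩
  fromℕ (suc a)                               ≡⟨ /-* (suc a) (suc b) ⟨
  (ℤ.+ suc a / suc b) * fromℕ (suc b)         ≡⟨ cong (_* fromℕ (suc b)) (ℚ.↥p/↧p≡p δ) ⟩
  δ * fromℕ (suc b)                           ≡⟨ ℚ.*-comm δ (fromℕ (suc b)) ⟩
  fromℕ (suc b) * δ                           ∎)
  where open ℚ.≤-Reasoning

-- The denominator found by `archimedean` may be far larger than 1/δ. Descending from it until the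
-- predecessor falls below 1 limits the overshoot to δ, and this bounds the number of rounds.
least-multiple : ∀ δ M → 1ℚ ≤ fromℕ M * δ → ∃[ m ] 1ℚ ≤ fromℕ m * δ × fromℕ m * δ ≤ 1ℚ + δ
least-multiple δ zero    1≤0 = contradiction (≤-≡-trans 1≤0 (ℚ.*-zeroˡ δ)) (from-no (1ℚ ℚ.≤? 0ℚ))
least-multiple δ (suc M) 1≤  = by (1ℚ ℚ.≤? fromℕ M * δ)
  where
  open ℚ.≤-Reasoning
  by : Dec (1ℚ ≤ fromℕ M * δ) → ∃[ m ] 1ℚ ≤ fromℕ m * δ × fromℕ m * δ ≤ 1ℚ + δ
  by (yes 1≤M) = least-multiple δ M 1≤M
  by (no 1≰M)  = suc M , 1≤ , (begin
    fromℕ (suc M) * δ     ≡⟨ cong (_* δ) (fromℕ-suc M) ⟩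
    (1ℚ + fromℕ M) * δ    ≡⟨ solve 2 (λ m d → (con 1ℚ :+ m) :* d := m :* d :+ d) refl (fromℕ M) δ ⟩
    fromℕ M * δ + δ       ≤⟨ ℚ.+-monoˡ-≤ δ (ℚ.<⇒≤ (ℚ.≰⇒> 1≰M)) ⟩
    1ℚ + δ                ∎)

n≤2^[1+⌊log₂n⌋] : ∀ n → n ℕ.≤ 2 ℕ.^ suc ⌊log₂ n ⌋
n≤2^[1+⌊log₂n⌋] n = ℕ.≮⇒≥ λ 2^<n → ℕ.1+n≰n (subst (ℕ._≤ ⌊log₂ n ⌋) (⌊log₂[2^n]⌋≡n (suc ⌊log₂ n ⌋)) (⌊log₂⌋-mono-≤ (ℕ.<⇒≤ 2^<n)))

-- With L = ⌊log₂ N⌋, enough halvings to bring n · n^(2k) down to 1.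
halvings : ℕ → ℕ → ℕ
halvings k L = suc L ℕ.* suc (2 ℕ.* k)

nB^k≤2^halvings : ∀ {P L} k → P ℕ.≤ 2 ℕ.^ suc L → P ℕ.* (P ℕ.* P) ℕ.^ k ℕ.≤ 2 ℕ.^ halvings k L
nB^k≤2^halvings {P} {L} k P≤ = begin
  P ℕ.* (P ℕ.* P) ℕ.^ k              ≡⟨ cong (λ x → P ℕ.* (P ℕ.* x) ℕ.^ k) (ℕ.*-identityʳ P) ⟨
  P ℕ.* (P ℕ.^ 2) ℕ.^ k              ≡⟨ cong (P ℕ.*_) (ℕ.^-*-assoc P 2 k) ⟩
  P ℕ.^ suc (2 ℕ.* k)                ≤⟨ ℕ.^-monoˡ-≤ (suc (2 ℕ.* k)) P≤ ⟩
  (2 ℕ.^ suc L) ℕ.^ suc (2 ℕ.* k)    ≡⟨ ℕ.^-*-assoc 2 (suc L) (suc (2 ℕ.* k)) ⟩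
  2 ℕ.^ halvings k L                 ∎
  where open ℕ.≤-Reasoning

-- Doubling `L` and tripling `k` absorbs the two increments, whence 2 · 3 = 6. Passing from `L` to
-- `L ^ 2` spends the second logarithm of the claimed bound.
halvings≤ : ∀ {k L} → 1 ℕ.≤ k → 1 ℕ.≤ L → halvings k L ℕ.≤ 6 ℕ.* (k ℕ.* L ℕ.^ 2)
halvings≤ {k} {L} 1≤k 1≤L = begin
  suc L ℕ.* suc (2 ℕ.* k)              ≤⟨ ℕ.*-mono-≤ (ℕ.+-monoˡ-≤ L 1≤L) (ℕ.+-monoˡ-≤ (2 ℕ.* k) 1≤k) ⟩
  (L ℕ.+ L) ℕ.* (k ℕ.+ 2 ℕ.* k)        ≡⟨ double-triple k L ⟩
  6 ℕ.* (k ℕ.* (L ℕ.* 1))              ≤⟨ ℕ.*-monoʳ-≤ 6 (ℕ.*-monoʳ-≤ k (ℕ.*-monoʳ-≤ L (ℕ.≤-trans 1≤L (ℕ.≤-reflexive (sym (ℕ.*-identityʳ L)))))) ⟩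
  6 ℕ.* (k ℕ.* L ℕ.^ 2)                ∎
  where
  open ℕ.≤-Reasoning
  double-triple : ∀ k L → (L ℕ.+ L) ℕ.* (k ℕ.+ 2 ℕ.* k) ≡ 6 ℕ.* (k ℕ.* (L ℕ.* 1))
  double-triple = solve-∀

-- Invariant of a run, Markov's inequality and the success probability

module _ {k : ℕ} (toks : Tokens n N k) where
  open Tokens toks

  tokenList : List (Fin N)
  tokenList = filter (_∈? tokens) (allFin N)

  tokenList-sorted : AllPairs Fin._<_ tokenList
  tokenList-sorted = AllPairs.filter⁺ (_∈? tokens) (AllPairs.tabulate⁺-< id)

  length-tokenList : length tokenList ℕ.≤ k
  length-tokenList = ℕ.≤-trans (length-filter-tabulate (_∈? tokens) id tokens λ _ x∈ → x∈) (ℕ.≤-reflexive ∣tokens∣≡k)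

  ∈-tokenList⁺ : ∀ {t} → t ∈ tokens → t ∈ˡ tokenList
  ∈-tokenList⁺ t∈ = ∈-filter⁺ (_∈? tokens) (∈-allFin _) t∈

  -- Without a knower `φ` would lose its meaning, as `recip 0` is 1; a label outside `tokens` could
  -- stand in the way of the smallest incomplete token.
  record Invariant (T : Knowledge n N) : Set where
    field
      only-tokens : ∀ u → T u ⊆ tokens
      all-held    : ∀ {t} → t ∈ tokens → Held T t

    held : All (Held T) tokenList
    held = All.tabulate λ t∈ → all-held (proj₂ (∈-filter⁻ (_∈? tokens) {xs = allFin N} t∈))

  open Invariant

  invariant-initial : Invariant initial
  invariant-initial .only-tokens = initial⊆
  invariant-initial .all-held t∈ = let u , t∈u , _ = unique t∈ in u , t∈u

  invariant-round : ∀ (nodes : Nodes n N) G (transfer : Transfer N ε) {T} → Invariant T →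
    Always Invariant (Round.round nodes G blindPropose (Transfer.run transfer) T)
  invariant-round nodes G transfer {T} inv = Always-round nodes G transfer T λ valid → record
    { only-tokens = λ u x∈ → let w , x∈w = proj₂ (update-grows nodes G transfer T valid u) x∈ in inv .only-tokens w x∈w
    ; all-held    = λ t∈ → let u , t∈u = inv .all-held t∈ in u , proj₁ (update-grows nodes G transfer T valid u) t∈u
    }

  complete⇒allKnowAll : ∀ {T} → All (Complete T) tokenList → AllKnowAll T
  complete⇒allKnowAll com u t∈ = All.lookup com (∈-tokenList⁺ t∈) u

  module _ (nodes : Nodes n N) (transfer : Transfer N ε) (G : DynamicGraph n) where

    private
      run : ℕ → Rand (Knowledge n N)
      run = blindMatch nodes transfer G initial

    invariant-run : ∀ f → Always Invariant (run f)
    invariant-run zero    = invariant-initial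
    invariant-run (suc f) = Always->>= (run f) (invariant-run f) λ _ →
      invariant-round nodes (DynamicGraph.graph G f) transfer

    -- Pathwise, 1 - nΨ is at most 1 on success and at most 0 otherwise; then expectations are
    -- taken.
    markov : 1 ℕ.≤ n → ∀ f → 1ℚ - fromℕ n * 𝔼 (Ψ tokenList) (run f) ≤ Pr allKnowAll? (run f)
    markov 1≤n f = begin
      1ℚ - fromℕ n * 𝔼 (Ψ tokenList) (run f)
        ≡⟨ solve 2 (λ n e → con 1ℚ :- n :* e := con 1ℚ :+ (:- n) :* e) refl (fromℕ n) (𝔼 (Ψ tokenList) (run f)) ⟩
      1ℚ + - fromℕ n * 𝔼 (Ψ tokenList) (run f)
        ≡⟨ cong₂ _+_ (sym (𝔼-const 1ℚ (run f))) (sym (𝔼-* (- fromℕ n) (Ψ tokenList) (run f))) ⟩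
      𝔼 (λ _ → 1ℚ) (run f) + 𝔼 (λ T → - fromℕ n * Ψ tokenList T) (run f)
        ≡⟨ 𝔼-+ (λ _ → 1ℚ) (λ T → - fromℕ n * Ψ tokenList T) (run f) ⟨
      𝔼 (λ T → 1ℚ + - fromℕ n * Ψ tokenList T) (run f)
        ≤⟨ 𝔼-mono (run f) (invariant-run f) (λ T inv → by T inv (allKnowAll? T)) ⟩
      𝔼 (λ T → 𝟙 (allKnowAll? T)) (run f) ∎
      where
      open ℚ.≤-Reasoning
      complement : ∀ {x y} → x ≤ fromℕ n * y → 1ℚ + - fromℕ n * y ≤ 1ℚ - x
      complement {x} {y} x≤ = ≤-by-gap (gap≥0 x≤)
        (solve 3 (λ n x y → con 1ℚ :- x := con 1ℚ :+ (:- n) :* y :+ (n :* y :- x)) refl (fromℕ n) x y)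
      by : ∀ T → Invariant T → (all? : Dec (AllKnowAll T)) → 1ℚ + - fromℕ n * Ψ tokenList T ≤ 𝟙 all?
      by T inv (yes _)  = complement (0≤* (0≤fromℕ n) (0≤Ψ 1≤n tokenList (held inv)))
      by T inv (no ¬all) = complement (incomplete⇒1≤nΨ 1≤n tokenList (held inv) (¬all ∘ complete⇒allKnowAll))

    module _ {ρ : ℚ} (0≤ρ : 0ℚ ≤ ρ)
             (step : ∀ f T → Invariant T →
               𝔼 (Ψ tokenList) (Round.round nodes (DynamicGraph.graph G f) blindPropose (Transfer.run transfer) T)
               ≤ ρ * Ψ tokenList T) where

      𝔼-Ψ-run : ∀ f → 𝔼 (Ψ tokenList) (run f) ≤ ρ ^^ f * Ψ tokenList initial
      𝔼-Ψ-run zero    = ℚ.≤-reflexive (sym (ℚ.*-identityˡ _))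
      𝔼-Ψ-run (suc f) = begin
        𝔼 (Ψ tokenList) (run (suc f))
          ≡⟨ 𝔼->>= (Ψ tokenList) (run f) _ ⟩
        𝔼 (λ T → 𝔼 (Ψ tokenList) (Round.round nodes (DynamicGraph.graph G f) blindPropose (Transfer.run transfer) T)) (run f)
          ≤⟨ 𝔼-mono (run f) (invariant-run f) (step f) ⟩
        𝔼 (λ T → ρ * Ψ tokenList T) (run f)
          ≡⟨ 𝔼-* ρ (Ψ tokenList) (run f) ⟩
        ρ * 𝔼 (Ψ tokenList) (run f)
          ≤⟨ *-monoʳ 0≤ρ (𝔼-Ψ-run f) ⟩
        ρ * (ρ ^^ f * Ψ tokenList initial)
          ≡⟨ ℚ.*-assoc ρ (ρ ^^ f) (Ψ tokenList initial) ⟨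
        ρ ^^ suc f * Ψ tokenList initial ∎
        where open ℚ.≤-Reasoning

      solves : 1 ℕ.< n → ∀ f K → ρ ^^ f * fromℕ (2 ℕ.^ K) ≤ 1ℚ → n ℕ.* (n ℕ.* n) ℕ.^ k ℕ.≤ 2 ℕ.^ K →
        SolvesGossipIn nodes toks run f
      solves 1<n f K decay≤ n≤ = ℚ.≤-trans
        (ℚ.+-monoʳ-≤ 1ℚ (ℚ.neg-antimono-≤ nE≤i)) (markov 1≤n f)
        where
        open ℚ.≤-Reasoning
        1≤n : 1 ℕ.≤ n
        1≤n = ℕ.<⇒≤ 1<n
        instance n≢0 : NonZero n
                 n≢0 = Nodes.n≢0 nodes
        decay E Ψ₀ i : ℚ
        decay = ρ ^^ f
        E = 𝔼 (Ψ tokenList) (run f)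
        Ψ₀ = Ψ tokenList initial
        i = ℤ.+ 1 / n
        0≤decay : 0ℚ ≤ decay
        0≤decay = 0≤^^ 0≤ρ f
        nnE≤1 : fromℕ n * (fromℕ n * E) ≤ 1ℚ
        nnE≤1 = begin
          fromℕ n * (fromℕ n * E)
            ≤⟨ *-monoʳ (0≤fromℕ n) (*-monoʳ (0≤fromℕ n) (𝔼-Ψ-run f)) ⟩
          fromℕ n * (fromℕ n * (decay * Ψ₀))
            ≡⟨ solve 3 (λ n p x → n :* (n :* (p :* x)) := p :* (n :* (n :* x))) refl (fromℕ n) decay Ψ₀ ⟩
          decay * (fromℕ n * (fromℕ n * Ψ₀))
            ≤⟨ *-monoʳ 0≤decay (*-monoʳ (0≤fromℕ n) (ℚ.≤-trans (nΨ≤weight 1≤n {T = initial} tokenList)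
                 (^^-monoʳ (1≤n*n 1≤n) length-tokenList))) ⟩
          decay * (fromℕ n * weight n k)
            ≡⟨ cong (λ x → decay * (fromℕ n * x)) (trans (fromℕ-^ (n ℕ.* n) k) (cong (_^^ k) (fromℕ-* n n))) ⟨
          decay * (fromℕ n * fromℕ ((n ℕ.* n) ℕ.^ k))
            ≡⟨ cong (decay *_) (fromℕ-* n ((n ℕ.* n) ℕ.^ k)) ⟨
          decay * fromℕ (n ℕ.* (n ℕ.* n) ℕ.^ k)
            ≤⟨ *-monoʳ 0≤decay (fromℕ-mono n≤) ⟩
          decay * fromℕ (2 ℕ.^ K)
            ≤⟨ decay≤ ⟩
          1ℚ ∎
        nE≤i : fromℕ n * E ≤ i
        nE≤i = begin
          fromℕ n * E                     ≡⟨ ℚ.*-identityˡ _ ⟨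
          1ℚ * (fromℕ n * E)              ≡⟨ cong (_* (fromℕ n * E)) (/-* 1 n) ⟨
          i * fromℕ n * (fromℕ n * E)     ≡⟨ ℚ.*-assoc i (fromℕ n) (fromℕ n * E) ⟩
          i * (fromℕ n * (fromℕ n * E))   ≤⟨ *-monoʳ (0≤1/ n) nnE≤1 ⟩
          i * 1ℚ                          ≡⟨ ℚ.*-identityʳ i ⟩
          i                               ∎

-- Bounds on the parameters and the choice of constants

½≤1-N^-c : ∀ (nodes : Nodes n N) c → 1 ℕ.≤ c → ½ ≤ 1ℚ - (Nodes.N^- nodes) c
½≤1-N^-c {n} {N} nodes c 1≤c = ≤-by-gap (0≤* 0≤½ (gap≥0 2ε≤1))
  (solve 1 (λ e → con 1ℚ :- e := con ½ :+ con ½ :* (con 1ℚ :- e :* con (fromℕ 2))) refl ((Nodes.N^- nodes) c))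
  where
  open ℚ.≤-Reasoning
  instance N^c≢0 : NonZero (N ℕ.^ c)
           N^c≢0 = ℕ.m^n≢0 N c {{Nodes.N≢0 nodes}}
  2≤N^c : 2 ℕ.≤ N ℕ.^ c
  2≤N^c = ℕ.≤-trans (ℕ.≤-trans (Nodes.1<n nodes) (Nodes.n≤N nodes))
    (subst (ℕ._≤ N ℕ.^ c) (ℕ.^-identityʳ N) (ℕ.^-monoʳ-≤ N {{Nodes.N≢0 nodes}} 1≤c))
  2ε≤1 : (Nodes.N^- nodes) c * fromℕ 2 ≤ 1ℚ
  2ε≤1 = begin
    (ℤ.+ 1 / N ℕ.^ c) * fromℕ 2            ≤⟨ *-monoʳ (0≤1/ (N ℕ.^ c)) (fromℕ-mono 2≤N^c) ⟩
    (ℤ.+ 1 / N ℕ.^ c) * fromℕ (N ℕ.^ c)    ≡⟨ /-* 1 (N ℕ.^ c) ⟩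
    1ℚ                                     ∎

module _ (G : DynamicGraph n) (1<n : 1 ℕ.< n) where
  open DynamicGraph G

  private
    node : Fin n
    node = Fin.fromℕ< (ℕ.<⇒≤ 1<n)

  dynamic-degree≤ : ∀ {Δ} → HasMaxDegree Δ → ∀ r u → degree (graph r) u ℕ.≤ Δ
  dynamic-degree≤ (_ , greatest) r u = let d , isMax = maxDegree-exists (graph r) node in
    ℕ.≤-trans (proj₂ isMax (u , refl)) (greatest (r , isMax))

  dynamic-expansion≤ : ∀ {α} → HasExpansion α → ∀ r {q} → (∃[ S ] Ratio (graph r) S q) → α ≤ q
  dynamic-expansion≤ (_ , least) r ratio = let β , isExp = expansion-exists (graph r) 1<n node in
    ℚ.≤-trans (least (r , isExp)) (proj₂ isExp ratio)

  dynamic-expansion-pos : ∀ {α} → HasExpansion α → Positive α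
  dynamic-expansion-pos ((r , isExp) , _) = expansion-positive (graph r) (connected r) isExp

  -- Singletons give the bound. With α > 0 it yields Δ ≥ 1, and it keeps `contraction` at most 1.
  expansion≤degree : ∀ {α Δ} → HasExpansion α → HasMaxDegree Δ → α ≤ fromℕ Δ
  expansion≤degree exp deg = let q , q≤ , ratio = singleton-ratio (graph 0) 1<n node in
    ℚ.≤-trans (dynamic-expansion≤ exp 0 (⁅ node ⁆ , ratio))
              (ℚ.≤-trans q≤ (fromℕ-mono (dynamic-degree≤ deg 0 node)))

module _ (Δ : ℕ) {α : ℚ} {α⁻¹ : ℚ} (0<α : Positive α) (αα⁻¹≡1 : α * α⁻¹ ≡ 1ℚ) (0≤α⁻¹ : 0ℚ ≤ α⁻¹)
         (α≤Δ : α ≤ fromℕ Δ) where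

  private
    c δ D : ℚ
    c = recip Δ
    δ = contraction c α
    D = fromℕ Δ

    0≤α : 0ℚ ≤ α
    0≤α = ℚ.<⇒≤ (ℚ.positive⁻¹ α {{0<α}})

    1≤Δ : 1 ℕ.≤ Δ
    1≤Δ = ℕ.n≢0⇒n>0 λ { refl → ℚ.<-irrefl refl (ℚ.<-≤-trans (ℚ.positive⁻¹ α {{0<α}}) α≤Δ) }

  recip-Δ : c * D ≡ 1ℚ
  recip-Δ = recip-* 1≤Δ

  private
    0≤c : 0ℚ ≤ c
    0≤c = 0≤recip Δ

    -- 32 is the product of the five halves in `contraction`: the share of the head, the
    -- linearization, the transfer, the receiver's coin and the sender's coin.
    δ*≡1 : δ * (fromℕ 32 * (D * D * α⁻¹)) ≡ 1ℚ
    δ*≡1 = begin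
      δ * (fromℕ 32 * (D * D * α⁻¹))
        ≡⟨ solve 4 (λ c a d b → con ½ :* (con ½ :* (con ½ :* (c :* (con ½ :* (con ½ :* c)))) :* a) :* (con (fromℕ 32) :* (d :* d :* b))
             := (c :* d) :* (c :* d) :* (a :* b)) refl c α D α⁻¹ ⟩
      c * D * (c * D) * (α * α⁻¹)
        ≡⟨ cong₂ (λ x y → x * x * y) recip-Δ αα⁻¹≡1 ⟩
      1ℚ ∎
      where open ≡-Reasoning

  0≤contraction : 0ℚ ≤ δ
  0≤contraction = 0≤* 0≤½ (0≤* (0≤* 0≤½ (0≤* 0≤½ (0≤* 0≤c (0≤* 0≤½ (0≤* 0≤½ 0≤c))))) 0≤α)

  contraction≤1 : δ ≤ 1ℚ
  contraction≤1 = begin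
    δ
      ≡⟨ solve 2 (λ c a → con ½ :* (con ½ :* (con ½ :* (c :* (con ½ :* (con ½ :* c)))) :* a)
           := con (ℤ.+ 1 / 32) :* (c :* (c :* a))) refl c α ⟩
    (ℤ.+ 1 / 32) * (c * (c * α))
      ≤⟨ *-monoʳ (0≤1/ 32) (*-mono {s = 1ℚ} {q = 1ℚ} 0≤c 0≤1 (recip≤1 Δ) (≤-≡-trans (*-monoʳ 0≤c α≤Δ) recip-Δ)) ⟩
    (ℤ.+ 1 / 32) * (1ℚ * 1ℚ)
      ≤⟨ ℚ.≤ᵇ⇒≤ _ ⟩
    1ℚ ∎
    where open ℚ.≤-Reasoning

  -- For the chosen m, mδ ≥ 1 makes the Bernoulli factor at least 2, and mδ ≤ 1 + δ ≤ 2 gives m ≤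
  -- 2/δ, where 1/δ = 32Δ²/α.
  halving-time : ∃[ m ] (1ℚ - δ) ^^ m * fromℕ 2 ≤ 1ℚ × fromℕ m ≤ fromℕ 64 * (D * D * α⁻¹)
  halving-time =
    let M , 1≤M = archimedean δ {{0<δ}}
        m , 1≤mδ , mδ≤ = least-multiple δ M 1≤M
    in m , half m 1≤mδ , short m mδ≤
    where
    open ℚ.≤-Reasoning
    X : ℚ
    X = fromℕ 32 * (D * D * α⁻¹)
    0<δ : Positive δ
    0<δ = ℚ.nonNeg∧nonZero⇒pos δ {{nonNegative 0≤contraction}} {{ℚ.≢-nonZero {δ} λ δ≡0 →
      ℚ.1≢0 (trans (sym δ*≡1) (trans (cong (_* X) δ≡0) (ℚ.*-zeroˡ X)))}}
    half : ∀ m → 1ℚ ≤ fromℕ m * δ → (1ℚ - δ) ^^ m * fromℕ 2 ≤ 1ℚ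
    half m 1≤mδ = begin
      (1ℚ - δ) ^^ m * (1ℚ + 1ℚ)             ≤⟨ *-monoʳ (0≤^^ (gap≥0 contraction≤1) m) (ℚ.+-monoʳ-≤ 1ℚ 1≤mδ) ⟩
      (1ℚ - δ) ^^ m * (1ℚ + fromℕ m * δ)    ≤⟨ bernoulli 0≤contraction contraction≤1 m ⟩
      1ℚ                                    ∎
    short : ∀ m → fromℕ m * δ ≤ 1ℚ + δ → fromℕ m ≤ fromℕ 64 * (D * D * α⁻¹)
    short m mδ≤ = begin
      fromℕ m
        ≡⟨ ℚ.*-identityʳ (fromℕ m) ⟨
      fromℕ m * 1ℚ
        ≡⟨ cong (fromℕ m *_) δ*≡1 ⟨
      fromℕ m * (δ * X)
        ≡⟨ ℚ.*-assoc (fromℕ m) δ X ⟨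
      fromℕ m * δ * X
        ≤⟨ *-monoˡ (0≤* (0≤fromℕ 32) (0≤* (0≤* (0≤fromℕ Δ) (0≤fromℕ Δ)) 0≤α⁻¹))
             (ℚ.≤-trans mδ≤ (ℚ.+-monoʳ-≤ 1ℚ contraction≤1)) ⟩
      (1ℚ + 1ℚ) * X
        ≡⟨ solve 1 (λ y → (con 1ℚ :+ con 1ℚ) :* (con (fromℕ 32) :* y) := con (fromℕ 64) :* y) refl (D * D * α⁻¹) ⟩
      fromℕ 64 * (D * D * α⁻¹) ∎

  -- 384 = 6 · 64, from the number of halvings and the length of each.
  rounds≤ : ∀ {m k L} → 1 ℕ.≤ k → 1 ℕ.≤ L → fromℕ m ≤ fromℕ 64 * (D * D * α⁻¹) →
            fromℕ (halvings k L ℕ.* m) ≤ fromℕ 384 * α⁻¹ * fromℕ (k ℕ.* Δ ℕ.^ 2 ℕ.* L ℕ.^ 2)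
  rounds≤ {m} {k} {L} 1≤k 1≤L m≤ = begin
    fromℕ (halvings k L ℕ.* m)
      ≡⟨ fromℕ-* (halvings k L) m ⟩
    fromℕ (halvings k L) * fromℕ m
      ≤⟨ *-mono (0≤fromℕ (halvings k L)) (0≤* (0≤fromℕ 64) (0≤* (0≤* (0≤fromℕ Δ) (0≤fromℕ Δ)) 0≤α⁻¹))
           (fromℕ-mono (halvings≤ 1≤k 1≤L)) m≤ ⟩
    fromℕ (6 ℕ.* (k ℕ.* L ℕ.^ 2)) * (fromℕ 64 * (D * D * α⁻¹))
      ≡⟨ cong (_* (fromℕ 64 * (D * D * α⁻¹))) (trans (fromℕ-* 6 (k ℕ.* L ℕ.^ 2)) (cong (fromℕ 6 *_) (fromℕ-* k (L ℕ.^ 2)))) ⟩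
    fromℕ 6 * (fromℕ k * l) * (fromℕ 64 * (D * D * α⁻¹))
      ≡⟨ solve 4 (λ k l d b → con (fromℕ 6) :* (k :* l) :* (con (fromℕ 64) :* (d :* d :* b))
           := con (fromℕ 384) :* b :* (k :* (d :* (d :* con 1ℚ)) :* l)) refl (fromℕ k) l D α⁻¹ ⟩
    fromℕ 384 * α⁻¹ * (fromℕ k * D ^^ 2 * l)
      ≡⟨ cong (fromℕ 384 * α⁻¹ *_) (trans (fromℕ-* (k ℕ.* Δ ℕ.^ 2) (L ℕ.^ 2))
           (cong (_* l) (trans (fromℕ-* k (Δ ℕ.^ 2)) (cong (fromℕ k *_) (fromℕ-^ Δ 2))))) ⟨
    fromℕ 384 * α⁻¹ * fromℕ (k ℕ.* Δ ℕ.^ 2 ℕ.* L ℕ.^ 2) ∎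
    where
    open ℚ.≤-Reasoning
    l : ℚ
    l = fromℕ (L ℕ.^ 2)

theorem4p1 : ∃[ c₀ ] ∀ c → c₀ ℕ.≤ c → ∃[ C ]
    ∀ {n N k : ℕ} (nodes : Nodes n N) (toks : Tokens n N k)
    (transfer : Transfer N (Nodes.N^-_ nodes c))
    (τ : StabilityFactor) (G : DynamicGraph n) → HasStability G τ →
    ∀ {α : ℚ} {Δ : ℕ} (exp : DynamicGraph.HasExpansion G α) →
    DynamicGraph.HasMaxDegree G Δ →
    ∃[ f ]
    fromℕ f ℚ.≤ fromℕ C ℚ.* (1/ α) {{expansion≢0 G exp}} ℚ.*
    -- N ≥ 2, so 1 ≤ ⌊log₂ N⌋ ≤ log₂ N < 2 ⌊log₂ N⌋
    fromℕ (k ℕ.* Δ ℕ.^ 2 ℕ.* ⌊log₂ N ⌋ ℕ.^ 2)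
    × SolvesGossipIn nodes toks
    (blindMatch nodes transfer G (Tokens.initial toks)) f
-- Since N ≥ 2, an exponent of at least 1 makes a transfer succeed with probability at least 1/2.
theorem4p1 = 1 , λ c 1≤c → 384 , λ {n} {N} {k} nodes toks transfer τ G _ {α} {Δ} exp deg →
  let
    1<n  = Nodes.1<n nodes
    1≤n  = ℕ.<⇒≤ 1<n
    2≤N  = ℕ.≤-trans 1<n (Nodes.n≤N nodes)
    0<α  = dynamic-expansion-pos G 1<n exp
    0≤α  = ℚ.<⇒≤ (ℚ.positive⁻¹ α {{0<α}})
    α⁻¹  = (1/ α) {{expansion≢0 G exp}}
    αα⁻¹ = ℚ.*-inverseʳ α {{expansion≢0 G exp}}
    0≤α⁻¹ = ℚ.<⇒≤ (ℚ.positive⁻¹ α⁻¹ {{ℚ.1/pos⇒pos α {{0<α}}}})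
    α≤Δ  = expansion≤degree G 1<n exp deg
    L    = ⌊log₂ N ⌋
    m , half , short = halving-time Δ 0<α αα⁻¹ 0≤α⁻¹ α≤Δ
    δ≤1  = contraction≤1 Δ 0<α αα⁻¹ 0≤α⁻¹ α≤Δ
    0≤ρ  = gap≥0 δ≤1
    step = λ r T inv → 𝔼-Ψ-round 1≤n nodes (DynamicGraph.graph G r) transfer T (½≤1-N^-c nodes c 1≤c)
             (dynamic-degree≤ G 1<n deg r) (0≤recip Δ) (ℚ.≤-reflexive (recip-Δ Δ 0<α αα⁻¹ 0≤α⁻¹ α≤Δ))
             0≤α (dynamic-expansion≤ G 1<n exp r)
             (tokenList toks) (tokenList-sorted toks) (Invariant.held inv)
             -- Nothing has been removed from the list yet, so every known token is still in it.
             (λ {_} {u} x∈ → inj₂ (∈-tokenList⁺ toks (Invariant.only-tokens inv u x∈)))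
  in halvings k L ℕ.* m ,
     rounds≤ Δ 0<α αα⁻¹ 0≤α⁻¹ α≤Δ {m} (Tokens.1≤k toks) (⌊log₂⌋-mono-≤ 2≤N) short ,
     solves toks nodes transfer G 0≤ρ step 1<n (halvings k L ℕ.* m) (halvings k L)
       (halving {m = m} 0≤ρ half (halvings k L))
       (nB^k≤2^halvings {L = L} k (ℕ.≤-trans (Nodes.n≤N nodes) (n≤2^[1+⌊log₂n⌋] N)))
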